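{- Let $\mathbb{F}$ be a finite field. The collection $\{\mathbb{P}: \mathbb{P}\text{ is a partial field and there is a partial-field homomorphism } \mathbb{P}\to\mathbb{F}\}$ is not well-quasi-ordered under the relation $\succeq_{\mathrm{Hom}}$.
   Context: A partial field is a pair $\mathbb{P}=(R,G)$ with $R$ a commutative ring with unity and $G$ a subgroup of $R^\times$ with $-1\in G$; elements of $\mathbb{P}$ are $0$ and the elements of $G$. A partial-field homomorphism $\phi:\mathbb{P}_1\to\mathbb{P}_2$ is a map on elements with $\phi(1)=1$, $\phi(pq)=\phi(p)\phi(q)$, and $\phi(p)+\phi(q)=\phi(r)$ whenever $p,q,r\in\mathbb{P}_1$ with $p+q=r$. The field $\mathbb{F}$ is regarded as the partial field $(\mathbb{F},\mathbb{F}^\times)$. Write $\mathbb{P}_2\succeq_{\mathrm{Hom}}\mathbb{P}_1$ if there is a partial-field homomorphism $\mathbb{P}_1\to\mathbb{P}_2$. A relation $\succeq$ on a collection $P$ is a well-quasi-ordering if it is reflexive, transitive, and for every infinite sequence $a_1,a_2,\dots$ in $P$ there exist $i>j$ with $a_i\succeq a_j$. -}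

module Defs where

open import Level using (Level; _⊔_; suc; 0ℓ)
open import Algebra.Bundles using (CommutativeRing)
open import Data.Nat using (ℕ; _>_)
open import Data.Fin using (Fin)
open import Data.Product using (Σ; ∃; ∃-syntax; _×_; _,_)
open import Data.Sum using (_⊎_)
open import Relation.Nullary using (¬_)

record PartialField (c ℓ : Level) : Set (suc (c ⊔ ℓ)) where
  field
    R : CommutativeRing c ℓ
  open CommutativeRing R public
  field
    G       : Carrier → Set ℓ
    G-resp  : ∀ {x y} → x ≈ y → G x → G y
    G-one   : G 1#
    G-mul   : ∀ {x y} → G x → G y → G (x * y)
    G-inv   : ∀ {x} → G x → Σ Carrier (λ y → G y × (x * y ≈ 1#))
    G-neg1  : G (- 1#)

  IsElem : Carrier → Set ℓ
  IsElem x = (x ≈ 0#) ⊎ G x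

record PFHom {c₁ ℓ₁ c₂ ℓ₂ : Level}
             (P₁ : PartialField c₁ ℓ₁) (P₂ : PartialField c₂ ℓ₂)
             : Set (c₁ ⊔ ℓ₁ ⊔ c₂ ⊔ ℓ₂) where
  private
    module A = PartialField P₁
    module B = PartialField P₂
  field
    φ       : (x : A.Carrier) → A.IsElem x → B.Carrier
    φ-elem  : ∀ x (p : A.IsElem x) → B.IsElem (φ x p)
    φ-cong  : ∀ {x y} (p : A.IsElem x) (q : A.IsElem y) → x A.≈ y → φ x p B.≈ φ y q
    φ-one   : (p : A.IsElem A.1#) → φ A.1# p B.≈ B.1#
    φ-mul   : ∀ {x y} (p : A.IsElem x) (q : A.IsElem y) (pq : A.IsElem (x A.* y)) →
              φ (x A.* y) pq B.≈ (φ x p B.* φ y q)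
    φ-add   : ∀ {x y z} (p : A.IsElem x) (q : A.IsElem y) (r : A.IsElem z) →
              (x A.+ y) A.≈ z → (φ x p B.+ φ y q) B.≈ φ z r

record FiniteField (c ℓ : Level) : Set (suc (c ⊔ ℓ)) where
  field
    R : CommutativeRing c ℓ
  open CommutativeRing R public
  field
    1≉0     : ¬ (1# ≈ 0#)
    inverse : ∀ x → ¬ (x ≈ 0#) → Σ Carrier (λ y → x * y ≈ 1#)
    size    : ℕ
    enum    : Fin size → Carrier
    enum-surj : ∀ x → ∃[ i ] (enum i ≈ x)

fieldAsPF : ∀ {c ℓ} → FiniteField c ℓ → PartialField c ℓ
fieldAsPF {c} {ℓ} F = record
  { R = R
  ; G = λ x → ¬ (x ≈ 0#)
  ; G-resp = λ x≈y nx y≈0 → nx (trans x≈y y≈0)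
  ; G-one = 1≉0
  ; G-mul = λ {x} {y} nx ny xy≈0 → mulNZ nx ny xy≈0
  ; G-inv = λ {x} nx → invG nx
  ; G-neg1 = λ m1≈0 → 1≉0 (neg-zero m1≈0)
  }
  where
  open FiniteField F
  open import Algebra.Properties.Ring (CommutativeRing.ring R) using (-‿involutive; -0#≈0#)
  open import Relation.Binary.Reasoning.Setoid setoid
  zeroʳ' : ∀ a → a * 0# ≈ 0#
  zeroʳ' a = zeroʳ a
  mulNZ : ∀ {x y} → ¬ (x ≈ 0#) → ¬ (y ≈ 0#) → ¬ (x * y ≈ 0#)
  mulNZ {x} {y} nx ny xy≈0 with inverse x nx
  ... | (u , xu≈1) = ny (begin
      y                ≈⟨ sym (*-identityˡ y) ⟩
      1# * y           ≈⟨ *-congʳ (sym xu≈1) ⟩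
      (x * u) * y      ≈⟨ *-congʳ (*-comm x u) ⟩
      (u * x) * y      ≈⟨ *-assoc u x y ⟩
      u * (x * y)      ≈⟨ *-congˡ xy≈0 ⟩
      u * 0#           ≈⟨ zeroʳ' u ⟩
      0#               ∎)
  invG : ∀ {x} → ¬ (x ≈ 0#) → Σ Carrier (λ y → ¬ (y ≈ 0#) × (x * y ≈ 1#))
  invG {x} nx with inverse x nx
  ... | (u , xu≈1) = u , (λ u≈0 → 1≉0 (begin
      1#     ≈⟨ sym xu≈1 ⟩
      x * u  ≈⟨ *-congˡ u≈0 ⟩
      x * 0# ≈⟨ zeroʳ' x ⟩
      0#     ∎)) , xu≈1
  neg-zero : - 1# ≈ 0# → 1# ≈ 0#
  neg-zero m1≈0 = begin
      1#       ≈⟨ sym (-‿involutive 1#) ⟩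
      - (- 1#) ≈⟨ -‿cong m1≈0 ⟩
      - 0#     ≈⟨ -0#≈0# ⟩
      0#       ∎

_⪰Hom_ : ∀ {c ℓ} → PartialField c ℓ → PartialField c ℓ → Set (c ⊔ ℓ)
Q ⪰Hom P = PFHom P Q

record IsWQO {a r : Level} (A : Set a) (_⪰_ : A → A → Set r) : Set (a ⊔ r) where
  field
    reflexive  : ∀ x → x ⪰ x
    transitive : ∀ {x y z} → x ⪰ y → y ⪰ z → x ⪰ z
    good       : (s : ℕ → A) → ∃[ i ] ∃[ j ] (i > j × (s i ⪰ s j))

HomToF : ∀ {c ℓ} → FiniteField c ℓ → Set (suc (c ⊔ ℓ))
HomToF {c} {ℓ} F = Σ (PartialField c ℓ) (λ P → PFHom P (fieldAsPF F))

_⪰H_ : ∀ {c ℓ} {F : FiniteField c ℓ} → HomToF F → HomToF F → Set (c ⊔ ℓ)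
(Q , _) ⪰H (P , _) = Q ⪰Hom P

{-# OPTIONS --safe #-}

-- If 1 + 1 ≠ 0 in F, then 2^t = 1 in F for some t > 0, and the rings ℤ/(2^(t i) - 1) with all their units map to F.
-- A homomorphism fixes all powers of 2, because 2^(k+1) = 2^k + 2^k, so there is none from a smaller modulus to
-- a larger one.
--
-- In characteristic 2 we use partial fields with only the trivial additive relations: an abelian group G with an
-- element a of order 2 gives the group ring ℤ[G]/(a + 1) with units G, every element of G can be sent to 1 in F,
-- and homomorphisms are group homomorphisms that preserve a. For countable G such homomorphisms are governed by
-- the height of a, an ordinal, so G has to be uncountable. For odd q let G_q consist of the formal
-- sums Σ u_n e_n with u_n = 2^(n-k) ε_n in ℤ[1/q] and ε bounded ("slow" sequences), where 4^n e_n = a for all n.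
-- If q ≡ 1 mod p, then a homomorphism f : G_p → G_q maps the p-divisible group G_p into the finitely supported
-- elements. But f is 2-adically continuous and 2^n f(e_n) has a coordinate m ≥ n that is nonzero mod 4^m, so a
-- sufficiently lacunary sum of the 2^n e_n has an image with infinite support.
module Submission where

open import Defs
open import Level using (0ℓ)
open import Algebra.Bundles using (AbelianGroup; CommutativeMonoid; CommutativeRing)
import Algebra.Properties.Semiring.Exp as Powers
import Algebra.Properties.Semiring.Mult as Multiples
open import Data.Bool using (Bool; true; false; _∧_; if_then_else_)
open import Data.Empty using (⊥; ⊥-elim)
open import Data.Fin using (toℕ)
import Data.Fin.Properties as Finₚ
open import Data.Integer using (ℤ; +_; 0ℤ; 1ℤ; ∣_∣)
open import Data.Integer.Divisibility.Signed
import Data.Integer.Properties as ℤₚ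
import Data.Integer.Tactic.RingSolver as ℤ-Solver
open import Data.List using (List; []; _∷_; _++_; map; length; [_])
import Data.List.Membership.Setoid as Membership
import Data.List.Membership.Setoid.Properties as Membershipₚ
import Data.List.Properties as Listₚ
import Data.List.Relation.Binary.Permutation.Setoid as Permutation
import Data.List.Relation.Binary.Permutation.Setoid.Properties as Permutationₚ
open import Data.List.Relation.Unary.Any using (here; there)
open import Data.Nat as ℕ using (ℕ; zero; suc; z≤n; s≤s; _≤_; _<_; _∸_; _≤?_; _≟_)
import Data.Nat.Divisibility as ℕᵈ
import Data.Nat.Properties as ℕₚ
import Data.Nat.Tactic.RingSolver as ℕ-Solver
open import Data.Product using (Σ; ∃; ∃-syntax; _,_; proj₁; proj₂)
open import Data.Sum using (inj₁; inj₂)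
open import Relation.Binary.Definitions using (tri<; tri≈; tri>)
open import Relation.Binary.PropositionalEquality as ≡ using (_≡_; _≢_; cong; cong₂; subst)
open import Relation.Nullary using (¬_; Dec; yes; no; does; contradiction)
open import Relation.Nullary.Decidable using (dec-true; dec-false)

Characteristic2 : FiniteField 0ℓ 0ℓ → Set
Characteristic2 F = 1# + 1# ≈ 0#
  where open FiniteField F

BadSequence : FiniteField 0ℓ 0ℓ → Set₁
BadSequence F = ∃ λ (s : ℕ → HomToF F) → ∀ {i j} → j < i → ¬ (_⪰H_ {F = F} (s i) (s j))

-- Characteristic other than 2: residue rings of Mersenne moduli

module OddCharacteristic where

  open import Data.Nat using (_+_; _*_; _^_)
  open ℕ-Solver using (solve-∀)
  open ≡ using (refl)

  -- ℤ/(1+n): the parameter is the modulus minus one.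
  module Residues (n : ℕ) where

    infix 4 _≋_

    -- Multiples of the modulus are added on both sides, so congruence is witnessed without
    -- subtraction on ℕ.
    _≋_ : ℕ → ℕ → Set
    x ≋ y = ∃[ k ] ∃[ l ] (x + k * suc n ≡ y + l * suc n)

    ≡⇒≋ : ∀ {x y} → x ≡ y → x ≋ y
    ≡⇒≋ x≡y = 0 , 0 , cong (_+ 0) x≡y

    ≋-sym : ∀ {x y} → x ≋ y → y ≋ x
    ≋-sym (k , l , eq) = l , k , ≡.sym eq

    ≋-trans : ∀ {x y z} → x ≋ y → y ≋ z → x ≋ z
    ≋-trans {x} {y} {z} (k , l , eq) (k′ , l′ , eq′) = k + k′ , l + l′ , (begin
      x + (k + k′) * m      ≡⟨ regroup x k k′ m ⟩
      x + k * m + k′ * m    ≡⟨ cong (_+ k′ * m) eq ⟩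
      y + l * m + k′ * m    ≡⟨ swap y l k′ m ⟩
      y + k′ * m + l * m    ≡⟨ cong (_+ l * m) eq′ ⟩
      z + l′ * m + l * m    ≡⟨ swap z l′ l m ⟩
      z + l * m + l′ * m    ≡⟨ regroup z l l′ m ⟨
      z + (l + l′) * m      ∎)
      where
      open ≡.≡-Reasoning
      m = suc n
      regroup : ∀ x k k′ m → x + (k + k′) * m ≡ x + k * m + k′ * m
      regroup = solve-∀
      swap : ∀ y l k m → y + l * m + k * m ≡ y + k * m + l * m
      swap = solve-∀

    +-cong : ∀ {x y u v} → x ≋ y → u ≋ v → x + u ≋ y + v
    +-cong {x} {y} {u} {v} (k , l , eq) (k′ , l′ , eq′) = k + k′ , l + l′ , (begin
      x + u + (k + k′) * m           ≡⟨ regroup x u k k′ m ⟩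
      (x + k * m) + (u + k′ * m)     ≡⟨ cong₂ _+_ eq eq′ ⟩
      (y + l * m) + (v + l′ * m)     ≡⟨ regroup y v l l′ m ⟨
      y + v + (l + l′) * m           ∎)
      where
      open ≡.≡-Reasoning
      m = suc n
      regroup : ∀ x u k k′ m → x + u + (k + k′) * m ≡ (x + k * m) + (u + k′ * m)
      regroup = solve-∀

    *-congˡ : ∀ c {x y} → x ≋ y → c * x ≋ c * y
    *-congˡ c {x} {y} (k , l , eq) = c * k , c * l , (begin
      c * x + c * k * m   ≡⟨ factor c x k m ⟩
      c * (x + k * m)     ≡⟨ cong (c *_) eq ⟩
      c * (y + l * m)     ≡⟨ factor c y l m ⟨
      c * y + c * l * m   ∎)
      where
      open ≡.≡-Reasoning
      m = suc n
      factor : ∀ c x k m → c * x + c * k * m ≡ c * (x + k * m)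
      factor = solve-∀

    *-cong : ∀ {x y u v} → x ≋ y → u ≋ v → x * u ≋ y * v
    *-cong {x} {y} {u} {v} x≋y u≋v =
      ≋-trans (*-congˡ x u≋v)
        (≋-trans (≡⇒≋ (ℕₚ.*-comm x v))
          (≋-trans (*-congˡ v x≋y) (≡⇒≋ (ℕₚ.*-comm v y))))

    -- Since `n` is congruent to -1, multiplication by `n` serves as negation.
    n*x+x≋0 : ∀ x → n * x + x ≋ 0
    n*x+x≋0 x = 0 , x , lemma n x
      where
      lemma : ∀ n x → n * x + x + 0 ≡ x * suc n
      lemma = solve-∀

    ring : CommutativeRing 0ℓ 0ℓ
    ring = record
      { Carrier = ℕ ; _≈_ = _≋_ ; _+_ = _+_ ; _*_ = _*_ ; -_ = n *_ ; 0# = 0 ; 1# = 1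
      ; isCommutativeRing = record
        { isRing = record
          { +-isAbelianGroup = record
            { isGroup = record
              { isMonoid = record
                { isSemigroup = record
                  { isMagma = record
                    { isEquivalence = record { refl = ≡⇒≋ refl ; sym = ≋-sym ; trans = ≋-trans }
                    ; ∙-cong = +-cong
                    }
                  ; assoc = λ x y z → ≡⇒≋ (ℕₚ.+-assoc x y z)
                  }
                ; identity = (λ x → ≡⇒≋ refl) , (λ x → ≡⇒≋ (ℕₚ.+-identityʳ x))
                }
              ; inverse = n*x+x≋0 , (λ x → ≋-trans (≡⇒≋ (ℕₚ.+-comm x (n * x))) (n*x+x≋0 x))
              ; ⁻¹-cong = *-congˡ n
              }
            ; comm = λ x y → ≡⇒≋ (ℕₚ.+-comm x y)
            }
          ; *-cong = *-cong
          ; *-assoc = λ x y z → ≡⇒≋ (ℕₚ.*-assoc x y z)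
          ; *-identity = (λ x → ≡⇒≋ (ℕₚ.*-identityˡ x)) , (λ x → ≡⇒≋ (ℕₚ.*-identityʳ x))
          ; distrib = (λ x y z → ≡⇒≋ (ℕₚ.*-distribˡ-+ x y z)) , (λ x y z → ≡⇒≋ (ℕₚ.*-distribʳ-+ x y z))
          }
        ; *-comm = λ x y → ≡⇒≋ (ℕₚ.*-comm x y)
        }
      }

  unitsPF : CommutativeRing 0ℓ 0ℓ → PartialField 0ℓ 0ℓ
  unitsPF S = record
    { R = S
    ; G = λ x → Σ Carrier λ y → x ⊗ y ≈ 1#
    ; G-resp = λ x≈y (u , xu≈1) → u , trans (*-congʳ (sym x≈y)) xu≈1
    ; G-one = 1# , *-identityˡ 1#
    ; G-mul = λ {x} {y} (u , xu≈1) (v , yv≈1) →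
        u ⊗ v , trans (interchange x y u v) (trans (*-cong xu≈1 yv≈1) (*-identityˡ 1#))
    ; G-inv = λ {x} (u , xu≈1) → u , (x , trans (*-comm u x) xu≈1) , xu≈1
    ; G-neg1 = - 1# , trans (-1*x≈-x (- 1#)) (-‿involutive 1#)
    }
    where
    open CommutativeRing S renaming (_*_ to _⊗_; _+_ to _⊕_)
    open import Algebra.Properties.Ring (CommutativeRing.ring S) using (-1*x≈-x; -‿involutive)
    open import Algebra.Properties.CommutativeSemigroup *-commutativeSemigroup using (interchange)

  residuesPF : ℕ → PartialField 0ℓ 0ℓ
  residuesPF n = unitsPF (Residues.ring n)

  -- Homomorphisms from residue rings to the finite field

  module ResiduesToField (F : FiniteField 0ℓ 0ℓ) where

    open FiniteField F using (1≉0; _≈_; 0#; 1#; semiring; setoid) renaming (_+_ to _⊕_; _*_ to _⊗_)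
    private module F = FiniteField F
    open Multiples semiring using (_×_; ×-homo-+; ×1-homo-*; ×-congˡ)
    open import Relation.Binary.Reasoning.Setoid setoid

    module _ (n : ℕ) (n×1≈0 : suc n × 1# ≈ 0#) where

      open Residues n

      multiple≈0 : ∀ k → (k * suc n) × 1# ≈ 0#
      multiple≈0 k = begin
        (k * suc n) × 1#          ≈⟨ ×1-homo-* k (suc n) ⟩
        (k × 1#) ⊗ (suc n × 1#)   ≈⟨ F.*-congˡ n×1≈0 ⟩
        (k × 1#) ⊗ 0#             ≈⟨ F.zeroʳ _ ⟩
        0#                        ∎

      absorb : ∀ x k → (x + k * suc n) × 1# ≈ x × 1#
      absorb x k = begin
        (x + k * suc n) × 1#           ≈⟨ ×-homo-+ 1# x (k * suc n) ⟩
        (x × 1#) ⊕ ((k * suc n) × 1#)  ≈⟨ F.+-congˡ (multiple≈0 k) ⟩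
        (x × 1#) ⊕ 0#                  ≈⟨ F.+-identityʳ _ ⟩
        x × 1#                         ∎

      -- The modulus is zero in `F` by `n×1≈0`, so the multiples of it in a congruence witness
      -- contribute nothing.
      ×1-cong : ∀ {x y} → x ≋ y → x × 1# ≈ y × 1#
      ×1-cong {x} {y} (k , l , eq) = begin
        x × 1#                 ≈⟨ absorb x k ⟨
        (x + k * suc n) × 1#   ≈⟨ ×-congˡ eq ⟩
        (y + l * suc n) × 1#   ≈⟨ absorb y l ⟩
        y × 1#                 ∎

      unit≉0 : ∀ x y → x * y ≋ 1 → ¬ (x × 1# ≈ 0#)
      unit≉0 x y xy≋1 x≈0 = 1≉0 (begin
        1#                       ≈⟨ F.+-identityʳ 1# ⟨
        1 × 1#                   ≈⟨ ×1-cong xy≋1 ⟨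
        (x * y) × 1#             ≈⟨ ×1-homo-* x y ⟩
        (x × 1#) ⊗ (y × 1#)      ≈⟨ F.*-congʳ x≈0 ⟩
        0# ⊗ (y × 1#)            ≈⟨ F.zeroˡ _ ⟩
        0#                       ∎)

      residues→field : PFHom (residuesPF n) (fieldAsPF F)
      residues→field = record
        { φ = λ x _ → x × 1#
        ; φ-elem = λ { x (inj₁ x≋0) → inj₁ (×1-cong x≋0)
                     ; x (inj₂ (y , xy≋1)) → inj₂ (unit≉0 x y xy≋1) }
        ; φ-cong = λ _ _ → ×1-cong
        ; φ-one = λ _ → F.+-identityʳ 1#
        ; φ-mul = λ {x} {y} _ _ _ → ×1-homo-* x y
        ; φ-add = λ {x} {y} _ _ _ x+y≋z → F.trans (F.sym (×-homo-+ 1# x y)) (×1-cong x+y≋z)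
        }

    open Powers semiring using (^-homo-*) renaming (_^_ to _↑_)

    2^_×1≈ : ∀ k → (2 ^ k) × 1# ≈ (2 × 1#) ↑ k
    2^ zero ×1≈ = F.+-identityʳ 1#
    2^ suc k ×1≈ = F.trans (×1-homo-* 2 (2 ^ k)) (F.*-congˡ (2^ k ×1≈))

    cancelˡ : ∀ {x y z} → ¬ (x ≈ 0#) → x ⊗ y ≈ x ⊗ z → y ≈ z
    cancelˡ {x} {y} {z} x≉0 xy≈xz with u , xu≈1 ← F.inverse x x≉0 = begin
      y              ≈⟨ undo y ⟨
      u ⊗ (x ⊗ y)    ≈⟨ F.*-congˡ xy≈xz ⟩
      u ⊗ (x ⊗ z)    ≈⟨ undo z ⟩
      z              ∎
      where
      undo : ∀ y → u ⊗ (x ⊗ y) ≈ y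
      undo y = begin
        u ⊗ (x ⊗ y)   ≈⟨ F.*-assoc u x y ⟨
        (u ⊗ x) ⊗ y   ≈⟨ F.*-congʳ (F.trans (F.*-comm u x) xu≈1) ⟩
        1# ⊗ y        ≈⟨ F.*-identityˡ y ⟩
        y             ∎

    ↑-nonzero : ∀ {x} → ¬ (x ≈ 0#) → ∀ k → ¬ (x ↑ k ≈ 0#)
    ↑-nonzero x≉0 zero = 1≉0
    ↑-nonzero {x} x≉0 (suc k) eq =
      ↑-nonzero x≉0 k (cancelˡ x≉0 (F.trans eq (F.sym (F.zeroʳ x))))

    finite-order : ∀ {x} → ¬ (x ≈ 0#) → ∃[ t ] (x ↑ suc t ≈ 1#)
    finite-order {x} x≉0
      -- There is one more exponent than there are indices of `enum`, so two powers of `x` share an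
      -- index; the smaller power is then cancelled.
      with i , j , i<j , eq ← Finₚ.pigeonhole (ℕₚ.n<1+n F.size)
             (λ k → proj₁ (F.enum-surj (x ↑ toℕ k)))
      = d , cancelˡ (↑-nonzero x≉0 (toℕ i)) (begin
          (x ↑ toℕ i) ⊗ (x ↑ suc d)   ≈⟨ ^-homo-* x (toℕ i) (suc d) ⟨
          x ↑ (toℕ i + suc d)         ≈⟨ F.reflexive (cong (x ↑_) i+d≡j) ⟩
          x ↑ toℕ j                   ≈⟨ proj₂ (F.enum-surj (x ↑ toℕ j)) ⟨
          F.enum _                    ≈⟨ F.reflexive (cong F.enum eq) ⟨
          F.enum _                    ≈⟨ proj₂ (F.enum-surj (x ↑ toℕ i)) ⟩
          x ↑ toℕ i                   ≈⟨ F.*-identityʳ _ ⟨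
          (x ↑ toℕ i) ⊗ 1#            ∎)
      where
      -- One less than the difference of the exponents, because the exponent delivered is `suc t`.
      d = toℕ j ∸ suc (toℕ i)
      i+d≡j : toℕ i + suc d ≡ toℕ j
      i+d≡j = ≡.trans (ℕₚ.+-suc (toℕ i) d) (ℕₚ.m+[n∸m]≡n i<j)

    ↑-multiple : ∀ {x} t → x ↑ t ≈ 1# → ∀ k → x ↑ (k * t) ≈ 1#
    ↑-multiple t eq zero = F.refl
    ↑-multiple {x} t eq (suc k) = begin
      x ↑ (t + k * t)         ≈⟨ ^-homo-* x t (k * t) ⟩
      (x ↑ t) ⊗ (x ↑ (k * t)) ≈⟨ F.*-cong eq (↑-multiple t eq k) ⟩
      1# ⊗ 1#                 ≈⟨ F.*-identityʳ 1# ⟩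
      1#                      ∎

    2^t≈1⇒mersenne≈0 : ∀ t n → 2 ^ t ≡ suc (suc n) → (2 × 1#) ↑ t ≈ 1# → suc n × 1# ≈ 0#
    2^t≈1⇒mersenne≈0 t n 2^t≡ 2^t≈1 = +-cancelˡ 1# _ _ (begin
      suc (suc n) × 1#   ≈⟨ ×-congˡ 2^t≡ ⟨
      (2 ^ t) × 1#       ≈⟨ 2^ t ×1≈ ⟩
      (2 × 1#) ↑ t       ≈⟨ 2^t≈1 ⟩
      1#                 ≈⟨ F.+-identityʳ 1# ⟨
      1# ⊕ 0#            ∎)
      where open import Algebra.Properties.Ring F.ring using (+-cancelˡ)

  -- Homomorphisms between residue rings

  -- The positive number `suc x` is a multiple of the modulus. `bound` strips equal multiples from
  -- both sides until a positive multiple remains on the right only.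
  residue≡1⇒modulus≤ : ∀ n x → Residues._≋_ n (suc (suc x)) 1 → n ≤ x
  residue≡1⇒modulus≤ n x (k , l , eq) = bound l k (ℕₚ.suc-injective eq)
    where
    bound : ∀ l k → suc x + k * suc n ≡ l * suc n → n ≤ x
    bound zero k ()
    bound (suc l) (suc k) eq = bound l k (ℕₚ.+-cancelʳ-≡ (suc n) _ _
       (≡.trans (lemma x k n) (≡.trans eq (ℕₚ.+-comm (suc n) (l * suc n)))))
      where
      lemma : ∀ x k n → suc x + k * suc n + suc n ≡ suc x + suc k * suc n
      lemma = solve-∀
    bound (suc l) zero eq = ℕₚ.≤-pred (subst (suc n ≤_) (≡.trans (≡.sym eq) (ℕₚ.+-identityʳ (suc x))) (ℕₚ.m≤m+n (suc n) (l * suc n)))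

  module ResiduesHom {n n′ : ℕ} (h : PFHom (residuesPF n) (residuesPF n′)) where

    open PFHom h
    private
      module A = PartialField (residuesPF n)
      module B = PartialField (residuesPF n′)

    -- Homomorphisms respect a sum only if it is again an element of the partial field; when 2 is a
    -- unit, all powers of 2 are elements and doubling can be iterated.
    φ[2^_] : ∀ k → (2∈G : A.G 2) (p : A.IsElem (2 ^ k)) → φ (2 ^ k) p B.≈ 2 ^ k
    φ[2^ zero ] _ p = φ-one p
    φ[2^ suc k ] 2∈G p = begin
      φ (2 ^ suc k) p                        ≈⟨ φ-add (inj₂ 2^k∈G) (inj₂ 2^k∈G) p (A.reflexive (lemma (2 ^ k))) ⟨
      φ (2 ^ k) _ + φ (2 ^ k) _              ≈⟨ B.+-cong (φ[2^ k ] 2∈G _) (φ[2^ k ] 2∈G _) ⟩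
      2 ^ k + 2 ^ k                          ≡⟨ lemma (2 ^ k) ⟩
      2 ^ suc k                              ∎
      where
      open import Relation.Binary.Reasoning.Setoid B.setoid
      lemma : ∀ x → x + x ≡ 2 * x
      lemma = solve-∀
      2^∈G : ∀ k → A.G (2 ^ k)
      2^∈G zero = A.G-one
      2^∈G (suc k) = A.G-mul {2} {2 ^ k} 2∈G (2^∈G k)
      2^k∈G = 2^∈G k

    -- The hypothesis makes 2^t an inverse of 2, so `φ[2^_]` applies, and the homomorphism fixes
    -- both sides of the equation.
    order-transfers : ∀ t → 2 ^ suc t A.≈ 1 → 2 ^ suc t B.≈ 1
    order-transfers t eq =
      B.trans (B.sym (φ[2^ suc t ] (2 ^ t , eq) p)) (B.trans (φ-cong p (inj₂ A.G-one) eq) (φ-one _))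
      where p = inj₂ (A.G-resp (A.sym eq) A.G-one)

    -- In the target, too, 2^(t+1) = 1, so the target modulus divides 2^(t+1) - 1, which is the
    -- source modulus.
    no-larger-mersenne : ∀ t → 2 ^ suc t ≡ suc (suc n) → n′ ≤ n
    no-larger-mersenne t eq = residue≡1⇒modulus≤ n′ n
      (B.trans (B.reflexive (≡.sym eq)) (order-transfers t (A.trans (A.reflexive eq) (0 , 1 , lemma n))))
      where
      lemma : ∀ n → suc (suc n) + 0 ≡ 1 + 1 * suc n
      lemma = solve-∀

  -- The sequence of Mersenne moduli

  module Mersenne (t : ℕ) where

    -- Here `suc t` will be an exponent with 2^(t+1) = 1 in `F`; its multiples inherit this
    -- property.
    exponent : ℕ → ℕ
    exponent i = suc i * suc t

    2≤2^[1+_] : ∀ k → 2 ≤ 2 ^ suc k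
    2≤2^[1+ k ] = ℕₚ.^-monoʳ-≤ 2 {1} {suc k} (s≤s z≤n)

    -- The Mersenne number lowered by one more, because `residuesPF` expects the modulus minus one.
    modulus : ℕ → ℕ
    modulus i = 2 ^ exponent i ∸ 2

    2^exponent : ∀ i → 2 ^ exponent i ≡ suc (suc (modulus i))
    2^exponent i = ≡.sym (ℕₚ.m+[n∸m]≡n 2≤2^[1+ t + i * suc t ])

    modulus-mono-< : ∀ {i j} → j < i → modulus j < modulus i
    modulus-mono-< {i} {j} j<i =
      ℕₚ.∸-monoˡ-< (ℕₚ.^-monoʳ-< 2 (s≤s (s≤s z≤n)) (ℕₚ.*-monoˡ-< (suc t) (s≤s j<i))) 2≤2^[1+ t + j * suc t ]

    no-hom : ∀ {i j} → j < i → ¬ PFHom (residuesPF (modulus j)) (residuesPF (modulus i))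
    no-hom {i} {j} j<i h = ℕₚ.<⇒≱ (modulus-mono-< j<i)
      (ResiduesHom.no-larger-mersenne {modulus j} {modulus i} h (t + j * suc t) (2^exponent j))

  bad-sequence-2≉0 : (F : FiniteField 0ℓ 0ℓ) → ¬ Characteristic2 F → BadSequence F
  bad-sequence-2≉0 F 2≉0 = (λ i → residuesPF (modulus i) , residues→field (modulus i)
        (2^t≈1⇒mersenne≈0 (exponent i) (modulus i) (2^exponent i) (↑-multiple (suc (proj₁ order)) (proj₂ order) (suc i))))
      , λ {i} {j} → no-hom {i} {j}
    where
    open ResiduesToField F
    module F = FiniteField F
    order = finite-order (λ eq → 2≉0 (F.trans (F.+-congˡ (F.sym (F.+-identityʳ F.1#))) eq))
    open Mersenne (proj₁ order)

-- Characteristic 2: group rings in which a group element is -1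

record SignedGroup : Set₁ where
  field
    abelianGroup : AbelianGroup 0ℓ 0ℓ
  open AbelianGroup abelianGroup public
  field
    a    : Carrier
    a²≈ε : a ∙ a ≈ ε

-- The group ring of 𝔾 over ℤ with a identified with -1
module GroupRing (𝔾 : SignedGroup) where

  open SignedGroup 𝔾
  open Permutation setoid hiding (refl; trans)
  open Permutationₚ setoid
  open Membership setoid using (_∈_)
  open import Algebra.Properties.CommutativeSemigroup
    (CommutativeMonoid.commutativeSemigroup ++-commutativeMonoid)
    using () renaming (interchange to ++-interchange)
  open PermutationReasoning

  private
    L : Set
    L = List Carrier

  a∙a∙ : ∀ x → a ∙ (a ∙ x) ≈ x
  a∙a∙ x = trans (sym (assoc a a x)) (trans (∙-congʳ a²≈ε) (identityˡ x))

  infixr 7 _·_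
  _·_ : Carrier → L → L
  x · ys = map (x ∙_) ys

  ·-cong : ∀ x {ys zs} → ys ↭ zs → x · ys ↭ x · zs
  ·-cong x = map⁺ setoid ∙-congˡ

  ·-assoc : ∀ x y zs → (x ∙ y) · zs ↭ x · y · zs
  ·-assoc x y [] = ↭-refl
  ·-assoc x y (z ∷ zs) = prep (assoc x y z) (·-assoc x y zs)

  ε· : ∀ ys → ε · ys ↭ ys
  ε· [] = ↭-refl
  ε· (y ∷ ys) = prep (identityˡ y) (ε· ys)

  ·-++ : ∀ x ys zs → x · (ys ++ zs) ↭ x · ys ++ x · zs
  ·-++ x ys zs = ↭-reflexive (Listₚ.map-++ (x ∙_) ys zs)

  infixl 7 _⊛_
  _⊛_ : L → L → L
  [] ⊛ ys = []
  (x ∷ xs) ⊛ ys = x · ys ++ xs ⊛ ys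

  ⊛-++ˡ : ∀ xs ys zs → (xs ++ ys) ⊛ zs ↭ xs ⊛ zs ++ ys ⊛ zs
  ⊛-++ˡ [] ys zs = ↭-refl
  ⊛-++ˡ (x ∷ xs) ys zs = begin
    x · zs ++ (xs ++ ys) ⊛ zs         ↭⟨ ++⁺ˡ (x · zs) (⊛-++ˡ xs ys zs) ⟩
    x · zs ++ (xs ⊛ zs ++ ys ⊛ zs)    ↭⟨ ++-assoc (x · zs) _ _ ⟨
    (x · zs ++ xs ⊛ zs) ++ ys ⊛ zs    ∎

  -- The mirror image of the defining clause of `_⊛_`, which recurses on the left factor;
  -- commutativity follows from it by induction.
  ⊛-∷ʳ : ∀ xs y ys → xs ⊛ (y ∷ ys) ↭ y · xs ++ xs ⊛ ys
  ⊛-∷ʳ [] y ys = ↭-refl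
  ⊛-∷ʳ (x ∷ xs) y ys = prep (comm x y) (begin
    x · ys ++ xs ⊛ (y ∷ ys)          ↭⟨ ++⁺ˡ (x · ys) (⊛-∷ʳ xs y ys) ⟩
    x · ys ++ (y · xs ++ xs ⊛ ys)    ↭⟨ shifts (x · ys) (y · xs) ⟩
    y · xs ++ (x · ys ++ xs ⊛ ys)    ∎)

  ⊛-comm : ∀ xs ys → xs ⊛ ys ↭ ys ⊛ xs
  ⊛-comm [] [] = ↭-refl
  ⊛-comm [] (y ∷ ys) = ⊛-comm [] ys
  ⊛-comm (x ∷ xs) ys = begin
    x · ys ++ xs ⊛ ys   ↭⟨ ++⁺ˡ (x · ys) (⊛-comm xs ys) ⟩
    x · ys ++ ys ⊛ xs   ↭⟨ ⊛-∷ʳ ys x xs ⟨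
    ys ⊛ (x ∷ xs)       ∎

  ·-⊛ : ∀ x ys zs → (x · ys) ⊛ zs ↭ x · (ys ⊛ zs)
  ·-⊛ x [] zs = ↭-refl
  ·-⊛ x (y ∷ ys) zs = begin
    (x ∙ y) · zs ++ (x · ys) ⊛ zs   ↭⟨ ++⁺ (·-assoc x y zs) (·-⊛ x ys zs) ⟩
    x · y · zs ++ x · (ys ⊛ zs)     ↭⟨ ·-++ x (y · zs) (ys ⊛ zs) ⟨
    x · (y · zs ++ ys ⊛ zs)         ∎

  ⊛-assoc : ∀ xs ys zs → (xs ⊛ ys) ⊛ zs ↭ xs ⊛ (ys ⊛ zs)
  ⊛-assoc [] ys zs = ↭-refl
  ⊛-assoc (x ∷ xs) ys zs = begin
    (x · ys ++ xs ⊛ ys) ⊛ zs            ↭⟨ ⊛-++ˡ (x · ys) (xs ⊛ ys) zs ⟩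
    (x · ys) ⊛ zs ++ (xs ⊛ ys) ⊛ zs     ↭⟨ ++⁺ (·-⊛ x ys zs) (⊛-assoc xs ys zs) ⟩
    x · (ys ⊛ zs) ++ xs ⊛ (ys ⊛ zs)     ∎

  ⊛-congʳ : ∀ xs {ys zs} → ys ↭ zs → xs ⊛ ys ↭ xs ⊛ zs
  ⊛-congʳ [] p = ↭-refl
  ⊛-congʳ (x ∷ xs) p = ++⁺ (·-cong x p) (⊛-congʳ xs p)

  ⊛-congˡ : ∀ {xs ys} zs → xs ↭ ys → xs ⊛ zs ↭ ys ⊛ zs
  ⊛-congˡ {xs} {ys} zs p = begin
    xs ⊛ zs   ↭⟨ ⊛-comm xs zs ⟩
    zs ⊛ xs   ↭⟨ ⊛-congʳ zs p ⟩
    zs ⊛ ys   ↭⟨ ⊛-comm zs ys ⟩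
    ys ⊛ zs   ∎

  neg : L → L
  neg xs = a · xs

  -- The multiple of `ps` by 1 + a; such sums are to become zero in the quotient.
  pairs : L → L
  pairs ps = ps ++ neg ps

  pairs-++ : ∀ ps qs → pairs (ps ++ qs) ↭ pairs ps ++ pairs qs
  pairs-++ ps qs = begin
    (ps ++ qs) ++ neg (ps ++ qs)        ↭⟨ ++⁺ˡ (ps ++ qs) (·-++ a ps qs) ⟩
    (ps ++ qs) ++ (neg ps ++ neg qs)    ↭⟨ ++-interchange ps qs (neg ps) (neg qs) ⟩
    (ps ++ neg ps) ++ (qs ++ neg qs)    ∎

  pairs-⊛ : ∀ ps zs → pairs ps ⊛ zs ↭ pairs (ps ⊛ zs)
  pairs-⊛ ps zs = begin
    (ps ++ neg ps) ⊛ zs        ↭⟨ ⊛-++ˡ ps (neg ps) zs ⟩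
    ps ⊛ zs ++ neg ps ⊛ zs     ↭⟨ ++⁺ˡ (ps ⊛ zs) (·-⊛ a ps zs) ⟩
    ps ⊛ zs ++ neg (ps ⊛ zs)   ∎

  pairs-neg : ∀ ps → neg (pairs ps) ↭ pairs (neg ps)
  pairs-neg ps = ·-++ a ps (neg ps)

  pairs-∷ : ∀ p ps → pairs (p ∷ ps) ↭ p ∷ a ∙ p ∷ pairs ps
  pairs-∷ p ps = ↭-prep p (↭-shift ps (neg ps))

  pairs-cong : ∀ {ps qs} → ps ↭ qs → pairs ps ↭ pairs qs
  pairs-cong p = ++⁺ p (·-cong a p)

  -- Lists stand for formal sums; equality imposes x + a x = 0.
  infix 4 _≃_
  record _≃_ (xs ys : L) : Set where
    constructor ⟨_,_,_⟩
    field
      ps qs    : L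
      balanced : xs ++ pairs ps ↭ ys ++ pairs qs

  ↭⇒≃ : ∀ {xs ys} → xs ↭ ys → xs ≃ ys
  ↭⇒≃ p = ⟨ [] , [] , ++⁺ʳ [] p ⟩

  ≃-sym : ∀ {xs ys} → xs ≃ ys → ys ≃ xs
  ≃-sym ⟨ ps , qs , p ⟩ = ⟨ qs , ps , ↭-sym p ⟩

  ≃-trans : ∀ {xs ys zs} → xs ≃ ys → ys ≃ zs → xs ≃ zs
  ≃-trans {xs} {ys} {zs} ⟨ ps , qs , p ⟩ ⟨ ps′ , qs′ , p′ ⟩ = ⟨ ps ++ ps′ , qs′ ++ qs , (begin
    xs ++ pairs (ps ++ ps′)            ↭⟨ ++⁺ˡ xs (pairs-++ ps ps′) ⟩
    xs ++ (pairs ps ++ pairs ps′)      ↭⟨ ++-assoc xs _ _ ⟨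
    (xs ++ pairs ps) ++ pairs ps′      ↭⟨ ++⁺ʳ (pairs ps′) p ⟩
    (ys ++ pairs qs) ++ pairs ps′      ↭⟨ ++-assoc ys _ _ ⟩
    ys ++ (pairs qs ++ pairs ps′)      ↭⟨ ++⁺ˡ ys (++-comm (pairs qs) (pairs ps′)) ⟩
    ys ++ (pairs ps′ ++ pairs qs)      ↭⟨ ++-assoc ys _ _ ⟨
    (ys ++ pairs ps′) ++ pairs qs      ↭⟨ ++⁺ʳ (pairs qs) p′ ⟩
    (zs ++ pairs qs′) ++ pairs qs      ↭⟨ ++-assoc zs _ _ ⟩
    zs ++ (pairs qs′ ++ pairs qs)      ↭⟨ ++⁺ˡ zs (pairs-++ qs′ qs) ⟨
    zs ++ pairs (qs′ ++ qs)            ∎) ⟩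

  ++-cong : ∀ {xs ys us vs} → xs ≃ ys → us ≃ vs → xs ++ us ≃ ys ++ vs
  ++-cong {xs} {ys} {us} {vs} ⟨ ps , qs , p ⟩ ⟨ ps′ , qs′ , p′ ⟩ = ⟨ ps ++ ps′ , qs ++ qs′ , (begin
    (xs ++ us) ++ pairs (ps ++ ps′)           ↭⟨ ++⁺ˡ (xs ++ us) (pairs-++ ps ps′) ⟩
    (xs ++ us) ++ (pairs ps ++ pairs ps′)     ↭⟨ ++-interchange xs us _ _ ⟩
    (xs ++ pairs ps) ++ (us ++ pairs ps′)     ↭⟨ ++⁺ p p′ ⟩
    (ys ++ pairs qs) ++ (vs ++ pairs qs′)     ↭⟨ ++-interchange ys vs _ _ ⟨
    (ys ++ vs) ++ (pairs qs ++ pairs qs′)     ↭⟨ ++⁺ˡ (ys ++ vs) (pairs-++ qs qs′) ⟨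
    (ys ++ vs) ++ pairs (qs ++ qs′)           ∎) ⟩

  neg-cong : ∀ {xs ys} → xs ≃ ys → neg xs ≃ neg ys
  neg-cong {xs} {ys} ⟨ ps , qs , p ⟩ = ⟨ neg ps , neg qs , (begin
    neg xs ++ pairs (neg ps)    ↭⟨ ++⁺ˡ (neg xs) (pairs-neg ps) ⟨
    neg xs ++ neg (pairs ps)    ↭⟨ ·-++ a xs (pairs ps) ⟨
    neg (xs ++ pairs ps)        ↭⟨ ·-cong a p ⟩
    neg (ys ++ pairs qs)        ↭⟨ ·-++ a ys (pairs qs) ⟩
    neg ys ++ neg (pairs qs)    ↭⟨ ++⁺ˡ (neg ys) (pairs-neg qs) ⟩
    neg ys ++ pairs (neg qs)    ∎) ⟩

  ⊛-cong₁ : ∀ {xs ys} zs → xs ≃ ys → xs ⊛ zs ≃ ys ⊛ zs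
  ⊛-cong₁ {xs} {ys} zs ⟨ ps , qs , p ⟩ = ⟨ ps ⊛ zs , qs ⊛ zs , (begin
    xs ⊛ zs ++ pairs (ps ⊛ zs)    ↭⟨ ++⁺ˡ (xs ⊛ zs) (pairs-⊛ ps zs) ⟨
    xs ⊛ zs ++ pairs ps ⊛ zs      ↭⟨ ⊛-++ˡ xs (pairs ps) zs ⟨
    (xs ++ pairs ps) ⊛ zs         ↭⟨ ⊛-congˡ zs p ⟩
    (ys ++ pairs qs) ⊛ zs         ↭⟨ ⊛-++ˡ ys (pairs qs) zs ⟩
    ys ⊛ zs ++ pairs qs ⊛ zs      ↭⟨ ++⁺ˡ (ys ⊛ zs) (pairs-⊛ qs zs) ⟩
    ys ⊛ zs ++ pairs (qs ⊛ zs)    ∎) ⟩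

  ⊛-cong : ∀ {xs ys us vs} → xs ≃ ys → us ≃ vs → xs ⊛ us ≃ ys ⊛ vs
  ⊛-cong {xs} {ys} {us} {vs} p q =
    ≃-trans (⊛-cong₁ us p)
      (≃-trans (↭⇒≃ (⊛-comm ys us))
        (≃-trans (⊛-cong₁ ys q) (↭⇒≃ (⊛-comm vs ys))))

  neg-inverseʳ : ∀ xs → xs ++ neg xs ≃ []
  neg-inverseʳ xs = ⟨ [] , xs , ++-identityʳ (pairs xs) ⟩

  ⊛-identityˡ : ∀ xs → [ ε ] ⊛ xs ↭ xs
  ⊛-identityˡ xs = ↭-trans (++-identityʳ (ε · xs)) (ε· xs)

  ⊛-distribˡ : ∀ xs ys zs → xs ⊛ (ys ++ zs) ↭ xs ⊛ ys ++ xs ⊛ zs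
  ⊛-distribˡ xs ys zs = begin
    xs ⊛ (ys ++ zs)       ↭⟨ ⊛-comm xs (ys ++ zs) ⟩
    (ys ++ zs) ⊛ xs       ↭⟨ ⊛-++ˡ ys zs xs ⟩
    ys ⊛ xs ++ zs ⊛ xs    ↭⟨ ++⁺ (⊛-comm ys xs) (⊛-comm zs xs) ⟩
    xs ⊛ ys ++ xs ⊛ zs    ∎

  ring : CommutativeRing 0ℓ 0ℓ
  ring = record
    { Carrier = L ; _≈_ = _≃_ ; _+_ = _++_ ; _*_ = _⊛_ ; -_ = neg ; 0# = [] ; 1# = [ ε ]
    ; isCommutativeRing = record
      { isRing = record
        { +-isAbelianGroup = record
          { isGroup = record
            { isMonoid = record
              { isSemigroup = record
                { isMagma = record
                  { isEquivalence = record { refl = ↭⇒≃ ↭-refl ; sym = ≃-sym ; trans = ≃-trans }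
                  ; ∙-cong = ++-cong
                  }
                ; assoc = λ xs ys zs → ↭⇒≃ (++-assoc xs ys zs)
                }
              ; identity = (λ xs → ↭⇒≃ ↭-refl) , (λ xs → ↭⇒≃ (++-identityʳ xs))
              }
            ; inverse = (λ xs → ≃-trans (↭⇒≃ (++-comm (neg xs) xs)) (neg-inverseʳ xs)) , neg-inverseʳ
            ; ⁻¹-cong = neg-cong
            }
          ; comm = λ xs ys → ↭⇒≃ (++-comm xs ys)
          }
        ; *-cong = ⊛-cong
        ; *-assoc = λ xs ys zs → ↭⇒≃ (⊛-assoc xs ys zs)
        ; *-identity = (λ xs → ↭⇒≃ (⊛-identityˡ xs)) ,
                       (λ xs → ↭⇒≃ (↭-trans (⊛-comm xs [ ε ]) (⊛-identityˡ xs)))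
        ; distrib = (λ xs ys zs → ↭⇒≃ (⊛-distribˡ xs ys zs)) , (λ xs ys zs → ↭⇒≃ (⊛-++ˡ ys zs xs))
        }
      ; *-comm = λ xs ys → ↭⇒≃ (⊛-comm xs ys)
      }
    }

  -- Additive relations between group elements

  -- As the partner a x of x is unique, a pair can be removed from a paired list together with its match.
  remove-pair : ∀ {x} ps → x ∈ pairs ps → ∃[ ps′ ] (pairs ps ↭ x ∷ a ∙ x ∷ pairs ps′)
  remove-pair {x} ps x∈ with Membershipₚ.∈-++⁻ setoid ps x∈
  ... | inj₁ x∈ps with us , vs , y , x≈y , eq ← Membershipₚ.∈-∃++ setoid x∈ps = us ++ vs , (begin
    pairs ps                        ↭⟨ pairs-cong (↭-reflexive-≋ eq) ⟩
    pairs (us ++ y ∷ vs)            ↭⟨ pairs-cong (shift (sym x≈y) us vs) ⟩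
    pairs (x ∷ us ++ vs)            ↭⟨ pairs-∷ x (us ++ vs) ⟩
    x ∷ a ∙ x ∷ pairs (us ++ vs)    ∎)
  remove-pair {x} ps x∈ | inj₂ x∈neg
    with z , z∈ps , x≈az ← Membershipₚ.∈-map⁻ setoid setoid x∈neg
    with us , vs , y , z≈y , eq ← Membershipₚ.∈-∃++ setoid z∈ps = us ++ vs , (begin
    pairs ps                        ↭⟨ pairs-cong (↭-reflexive-≋ eq) ⟩
    pairs (us ++ y ∷ vs)            ↭⟨ pairs-cong (shift (sym z≈y) us vs) ⟩
    pairs (z ∷ us ++ vs)            ↭⟨ pairs-∷ z (us ++ vs) ⟩
    -- Here `x` is the second member a z of its pair, so the members are exchanged, using z = a (a
    -- z) = a x.
    z ∷ a ∙ z ∷ pairs (us ++ vs)    ↭⟨ swap (trans (sym (a∙a∙ z)) (∙-congˡ (sym x≈az))) (sym x≈az) ↭-refl ⟩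
    x ∷ a ∙ x ∷ pairs (us ++ vs)    ∎)

  -- Induction on `ps`: its head occurs among `pairs qs`, where `remove-pair` finds the partner as
  -- well, so the same pair drops out on both sides. A sum equal to zero is therefore itself a list
  -- of pairs.
  cancel-pairs : ∀ xs ps qs → xs ++ pairs ps ↭ pairs qs → ∃[ qs′ ] (xs ↭ pairs qs′)
  cancel-pairs xs [] qs p = qs , ↭-trans (↭-sym (++-identityʳ xs)) p
  cancel-pairs xs (x ∷ ps) qs p = cancel-pairs xs ps qs′ (drop-∷ (drop-∷ (begin
      x ∷ a ∙ x ∷ xs ++ pairs ps          ↭⟨ ↭-prep x (↭-shift xs (pairs ps)) ⟨
      x ∷ xs ++ a ∙ x ∷ pairs ps          ↭⟨ ↭-shift xs (a ∙ x ∷ pairs ps) ⟨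
      xs ++ x ∷ a ∙ x ∷ pairs ps          ↭⟨ ++⁺ˡ xs (pairs-∷ x ps) ⟨
      xs ++ pairs (x ∷ ps)                ↭⟨ p ⟩
      pairs qs                            ↭⟨ proj₂ removed ⟩
      x ∷ a ∙ x ∷ pairs qs′               ∎)))
    where
    removed = remove-pair qs (∈-resp-↭ p (Membershipₚ.∈-++⁺ʳ setoid xs (here refl)))
    qs′ = proj₁ removed

  ≃[]⇒↭pairs : ∀ {xs} → xs ≃ [] → ∃[ qs ] (xs ↭ pairs qs)
  ≃[]⇒↭pairs {xs} ⟨ ps , qs , p ⟩ = cancel-pairs xs ps qs p

  unit≄[] : ∀ {x} → ¬ ([ x ] ≃ [])
  unit≄[] x≃[] with ≃[]⇒↭pairs x≃[]
  ... | [] , p = ¬x∷xs↭[] p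
  ... | q ∷ qs , p = contradiction (xs↭ys⇒|xs|≡|ys| (↭-trans p (pairs-∷ q qs))) λ ()

  -- Removing `x` and its partner leaves `y` to match a x; a match in a further pair would make the
  -- list too long. This lets a homomorphism recover `a` from addition.
  x+y≃0⇒ : ∀ {x y} → x ∷ y ∷ [] ≃ [] → y ≈ a ∙ x
  x+y≃0⇒ {x} {y} eq with ≃[]⇒↭pairs eq
  ... | [] , p = ⊥-elim (¬x∷xs↭[] p)
  ... | qs@(_ ∷ _) , p with qs′ , p′ ← remove-pair {x} qs (∈-resp-↭ p (here refl))
    with ∈-resp-↭ (drop-∷ (↭-trans p p′)) (here refl)
  ...   | here y≈ax = y≈ax
  ...   | there y∈ with qs″ , p″ ← remove-pair qs′ y∈ =
    contradiction (xs↭ys⇒|xs|≡|ys| (↭-trans p (↭-trans p′ (++⁺ˡ (x ∷ a ∙ x ∷ []) p″)))) λ ()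

  -- If x = y in the ring then x + a y = 0, so a y = a x by `x+y≃0⇒`. Ring equations between single
  -- group elements can thus be read in the group.
  unit-injective : ∀ {x y} → [ x ] ≃ [ y ] → x ≈ y
  unit-injective {x} {y} eq = trans (sym (a∙a∙ x)) (trans (∙-congˡ (sym (x+y≃0⇒ (≃-trans
    (++-cong eq (↭⇒≃ {[ a ∙ y ]} ↭-refl)) (neg-inverseʳ [ y ]))))) (a∙a∙ y))

  partialField : PartialField 0ℓ 0ℓ
  partialField = record
    { R = ring
    ; G = λ xs → ∃[ x ] (xs ≃ [ x ])
    ; G-resp = λ eq (x , eq′) → x , ≃-trans (≃-sym eq) eq′
    ; G-one = ε , ↭⇒≃ ↭-refl
    ; G-mul = λ (x , eq) (y , eq′) → x ∙ y , ⊛-cong eq eq′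
    ; G-inv = λ (x , eq) → [ x ⁻¹ ] , (x ⁻¹ , ↭⇒≃ ↭-refl) ,
        ≃-trans (⊛-cong₁ [ x ⁻¹ ] eq) (↭⇒≃ (prep (inverseʳ x) ↭-refl))
    ; G-neg1 = a ∙ ε , ↭⇒≃ ↭-refl
    }

-- The augmentation map to a field of characteristic 2

module AugmentationToField (F : FiniteField 0ℓ 0ℓ)
  (2≈0 : Characteristic2 F) (𝔾 : SignedGroup) where

  open FiniteField F

  open SignedGroup 𝔾 using (a) renaming (Carrier to G; setoid to G-setoid)
  open GroupRing 𝔾 using (_·_; _⊛_; neg; pairs; _≃_; ⟨_,_,_⟩; partialField)
  open Permutation G-setoid using (_↭_)
  open Permutationₚ G-setoid using (xs↭ys⇒|xs|≡|ys|)
  open import Algebra.Properties.Semiring.Mult semiring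
    using () renaming (_×_ to _⨯_; ×-homo-+ to ⨯-homo-+)
  open import Relation.Binary.Reasoning.Setoid setoid

  augment : List G → Carrier
  augment xs = length xs ⨯ 1#

  augment-↭ : ∀ {xs ys} → xs ↭ ys → augment xs ≈ augment ys
  augment-↭ p = reflexive (cong (_⨯ 1#) (xs↭ys⇒|xs|≡|ys| p))

  augment-++ : ∀ xs ys → augment (xs ++ ys) ≈ augment xs + augment ys
  augment-++ xs ys = trans (reflexive (cong (_⨯ 1#) (Listₚ.length-++ xs))) (⨯-homo-+ 1# (length xs) (length ys))

  augment-· : ∀ x ys → augment (x · ys) ≈ augment ys
  augment-· x ys = reflexive (cong (_⨯ 1#) (Listₚ.length-map _ ys))

  augment-⊛ : ∀ xs ys → augment (xs ⊛ ys) ≈ augment xs * augment ys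
  augment-⊛ [] ys = sym (zeroˡ _)
  augment-⊛ (x ∷ xs) ys = begin
    augment (x · ys ++ xs ⊛ ys)                      ≈⟨ augment-++ (x · ys) (xs ⊛ ys) ⟩
    augment (x · ys) + augment (xs ⊛ ys)             ≈⟨ +-cong (augment-· x ys) (augment-⊛ xs ys) ⟩
    augment ys + augment xs * augment ys             ≈⟨ +-congʳ (*-identityˡ _) ⟨
    1# * augment ys + augment xs * augment ys        ≈⟨ distribʳ _ _ _ ⟨
    (1# + augment xs) * augment ys                   ∎

  x+x≈0 : ∀ x → x + x ≈ 0#
  x+x≈0 x = begin
    x + x             ≈⟨ +-cong (*-identityˡ x) (*-identityˡ x) ⟨
    1# * x + 1# * x   ≈⟨ distribʳ _ _ _ ⟨
    (1# + 1#) * x     ≈⟨ *-congʳ 2≈0 ⟩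
    0# * x            ≈⟨ zeroˡ x ⟩
    0#                ∎

  -- A pair p + a p has augmentation 1 + 1; this is where characteristic 2 enters.
  augment-drop-pairs : ∀ xs ps → augment (xs ++ pairs ps) ≈ augment xs
  augment-drop-pairs xs ps = begin
    augment (xs ++ (ps ++ neg ps))                      ≈⟨ augment-++ xs _ ⟩
    augment xs + augment (ps ++ neg ps)                 ≈⟨ +-congˡ (augment-++ ps _) ⟩
    augment xs + (augment ps + augment (neg ps))        ≈⟨ +-congˡ (+-congˡ (augment-· a ps)) ⟩
    augment xs + (augment ps + augment ps)              ≈⟨ +-congˡ (x+x≈0 _) ⟩
    augment xs + 0#                                     ≈⟨ +-identityʳ _ ⟩
    augment xs                                          ∎

  augment-cong : ∀ {xs ys} → xs ≃ ys → augment xs ≈ augment ys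
  augment-cong {xs} {ys} ⟨ ps , qs , p ⟩ = begin
    augment xs                  ≈⟨ augment-drop-pairs xs ps ⟨
    augment (xs ++ pairs ps)    ≈⟨ augment-↭ p ⟩
    augment (ys ++ pairs qs)    ≈⟨ augment-drop-pairs ys qs ⟩
    augment ys                  ∎

  groupRing→field : PFHom partialField (fieldAsPF F)
  groupRing→field = record
    { φ = λ xs _ → augment xs
    ; φ-elem = λ { xs (inj₁ xs≃[]) → inj₁ (augment-cong xs≃[])
                 ; xs (inj₂ (x , xs≃x)) → inj₂ λ xs≈0 →
                     1≉0 (trans (sym (+-identityʳ 1#)) (trans (sym (augment-cong xs≃x)) xs≈0)) }
    ; φ-cong = λ _ _ → augment-cong
    ; φ-one = λ _ → +-identityʳ 1#
    ; φ-mul = λ {xs} {ys} _ _ _ → augment-⊛ xs ys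
    ; φ-add = λ {xs} {ys} _ _ _ eq → trans (sym (augment-++ xs ys)) (augment-cong eq)
    }

-- From partial-field homomorphisms to group homomorphisms

module GroupRingHom {𝔾 ℍ : SignedGroup}
  (h : PFHom (GroupRing.partialField 𝔾) (GroupRing.partialField ℍ)) where

  open PFHom h
  private
    module G = SignedGroup 𝔾
    module H = SignedGroup ℍ
    module RG = GroupRing 𝔾
    module RH = GroupRing ℍ
    module A = PartialField RG.partialField
    module B = PartialField RH.partialField

  elem : ∀ x → A.IsElem [ x ]
  elem x = inj₂ (x , A.refl)

  -- The definition of a homomorphism does not mention zero, but the relation 0 + 0 = 0 forces its
  -- image.
  φ[] : φ [] (inj₁ A.refl) B.≈ []
  φ[] = +-cancelˡ _ _ _ (B.trans (φ-add {[]} {[]} {[]} (inj₁ A.refl) (inj₁ A.refl) (inj₁ A.refl) A.refl) (B.sym (B.+-identityʳ _)))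
    where open import Algebra.Properties.Ring (CommutativeRing.ring B.R) using (+-cancelˡ)

  -- If `x` went to zero, so would the product of `x` and its inverse, yet 1 goes to 1 and 1 is
  -- nonzero in the target.
  φ-unit : ∀ x → ∃[ y ] (φ [ x ] (elem x) B.≈ [ y ])
  φ-unit x with φ-elem [ x ] (elem x)
  ... | inj₂ y = y
  ... | inj₁ φx≈0 = contradiction (begin
      B.1#                                            ≈⟨ φ-one (elem G.ε) ⟨
      φ [ G.ε ] (elem G.ε)                            ≈⟨ φ-cong _ (elem (x G.∙ x G.⁻¹)) (RG.↭⇒≃ (Permutation.prep (G.sym (G.inverseʳ x)) (Permutation.↭-refl G.setoid))) ⟩
      φ [ x G.∙ x G.⁻¹ ] (elem _)                     ≈⟨ φ-mul (elem x) (elem (x G.⁻¹)) _ ⟩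
      φ [ x ] (elem x) B.* φ [ x G.⁻¹ ] (elem _)      ≈⟨ B.*-congʳ φx≈0 ⟩
      B.0# B.* φ [ x G.⁻¹ ] (elem _)                  ≈⟨ B.zeroˡ (φ [ x G.⁻¹ ] (elem _)) ⟩
      B.0#                                            ∎) RH.unit≄[]
    where open import Relation.Binary.Reasoning.Setoid B.setoid

  f : G.Carrier → H.Carrier
  f x = proj₁ (φ-unit x)

  f-cong : ∀ {x y} → x G.≈ y → f x H.≈ f y
  f-cong {x} {y} x≈y = RH.unit-injective (B.trans (B.sym (proj₂ (φ-unit x)))
    (B.trans (φ-cong _ _ (RG.↭⇒≃ (Permutation.prep x≈y (Permutation.↭-refl G.setoid)))) (proj₂ (φ-unit y))))

  f-homo : ∀ x y → f (x G.∙ y) H.≈ f x H.∙ f y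
  f-homo x y = RH.unit-injective (B.trans (B.sym (proj₂ (φ-unit (x G.∙ y))))
    (B.trans (φ-mul (elem x) (elem y) _) (B.*-cong (proj₂ (φ-unit x)) (proj₂ (φ-unit y)))))

  -- Additivity carries 1 + a = 0 to 1 + f a = 0, whose only solution is `a`.
  f-a : f G.a H.≈ H.a
  f-a = H.trans (RH.x+y≃0⇒ (begin
      B.1# B.+ [ f G.a ]                              ≈⟨ B.+-cong (φ-one (elem G.ε)) (proj₂ (φ-unit G.a)) ⟨
      φ [ G.ε ] (elem G.ε) B.+ φ [ G.a ] (elem G.a)     ≈⟨ φ-add _ _ _ ε+a≃0 ⟩
      φ [] (inj₁ A.refl)                            ≈⟨ φ[] ⟩
      B.0#                                          ∎)) (H.identityʳ H.a)
    where
    open import Relation.Binary.Reasoning.Setoid B.setoid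
    ε+a≃0 : G.ε ∷ G.a ∷ [] RG.≃ []
    ε+a≃0 = RG.≃-trans (RG.↭⇒≃ (Permutation.prep G.refl (Permutation.prep (G.sym (G.identityʳ G.a)) (Permutation.↭-refl G.setoid))))
              (RG.neg-inverseʳ [ G.ε ])

-- Integer arithmetic: coprimality, powers and divisibility

module SlowSequences where

  open import Data.Product using (_×_)
  open import Data.Integer using (-_; _+_; _*_; _-_; _^_; NonZero; ≢-nonZero)
  open ℤ-Solver using (solve-∀)
  open ≡ using (refl; sym; trans; module ≡-Reasoning)

  -- Bézout certificates can be multiplied together and yield Euclid's lemma directly.
  Coprime : ℤ → ℤ → Set
  Coprime c d = ∃[ α ] ∃[ β ] (α * c + β * d ≡ 1ℤ)

  coprime-sym : ∀ {c d} → Coprime c d → Coprime d c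
  coprime-sym {c} {d} (α , β , eq) = β , α , trans (ℤₚ.+-comm (β * d) (α * c)) eq

  coprime-*ʳ : ∀ {c d d′} → Coprime c d → Coprime c d′ → Coprime c (d * d′)
  coprime-*ʳ {c} {d} {d′} (α , β , eq) (α′ , β′ , eq′) =
    α * α′ * c + α * β′ * d′ + β * d * α′ , β * β′ ,
    trans (expand c d d′ α β α′ β′) (cong₂ _*_ eq eq′)
    where
    expand : ∀ c d d′ α β α′ β′ →
      (α * α′ * c + α * β′ * d′ + β * d * α′) * c + β * β′ * (d * d′) ≡ (α * c + β * d) * (α′ * c + β′ * d′)
    expand = solve-∀

  coprime-^ʳ : ∀ {c d} → Coprime c d → ∀ n → Coprime c (d ^ n)
  coprime-^ʳ c⊥d zero = 0ℤ , 1ℤ , refl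
  coprime-^ʳ c⊥d (suc n) = coprime-*ʳ c⊥d (coprime-^ʳ c⊥d n)

  coprime-^ : ∀ {c d} → Coprime c d → ∀ m n → Coprime (c ^ m) (d ^ n)
  coprime-^ c⊥d m n = coprime-^ʳ (coprime-sym (coprime-^ʳ (coprime-sym c⊥d) m)) n

  coprime-divisor : ∀ {c d v} → Coprime c d → d ∣ c * v → d ∣ v
  coprime-divisor {c} {d} {v} (α , β , eq) (divides k cv≡kd) = divides (α * k + β * v) (begin
    v                           ≡⟨ ℤₚ.*-identityˡ v ⟨
    1ℤ * v                      ≡⟨ cong (_* v) eq ⟨
    (α * c + β * d) * v         ≡⟨ expand α β c d v ⟩
    α * (c * v) + β * v * d     ≡⟨ cong (λ z → α * z + β * v * d) cv≡kd ⟩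
    α * (k * d) + β * v * d     ≡⟨ factor α β k d v ⟩
    (α * k + β * v) * d         ∎)
    where
    open ≡-Reasoning
    expand : ∀ α β c d v → (α * c + β * d) * v ≡ α * (c * v) + β * v * d
    expand = solve-∀
    factor : ∀ α β k d v → α * (k * d) + β * v * d ≡ (α * k + β * v) * d
    factor = solve-∀

  ^-nonZero : ∀ b .{{_ : NonZero b}} n → NonZero (b ^ n)
  ^-nonZero b n = ≢-nonZero λ eq → ℤ≢0 b (ℤₚ.i^n≡0⇒i≡0 b n eq)
    where
    ℤ≢0 : ∀ i .{{_ : NonZero i}} → i ≢ 0ℤ
    ℤ≢0 (+ suc n) ()

  ^-cancelˡ : ∀ b .{{_ : NonZero b}} n {x y} → b ^ n * x ≡ b ^ n * y → x ≡ y
  ^-cancelˡ b n {x} {y} = ℤₚ.*-cancelˡ-≡ (b ^ n) x y {{^-nonZero b n}}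

  abs-^ : ∀ b n → ∣ b ^ n ∣ ≡ ∣ b ∣ ℕ.^ n
  abs-^ b zero = refl
  abs-^ b (suc n) = trans (ℤₚ.abs-* b (b ^ n)) (cong (∣ b ∣ ℕ.*_) (abs-^ b n))

  n<b^n : ∀ {b} → 2 ≤ b → ∀ n → n < b ℕ.^ n
  n<b^n 2≤b zero = s≤s z≤n
  n<b^n {b} 2≤b (suc n) = ℕₚ.≤-trans
    (ℕₚ.+-mono-≤ {1} (ℕₚ.≤-trans (s≤s z≤n) (n<b^n 2≤b n)) (ℕₚ.≤-trans (n<b^n 2≤b n) (ℕₚ.m≤m+n _ 0)))
    (ℕₚ.*-monoˡ-≤ (b ℕ.^ n) 2≤b)

  ∣∧<⇒≡0 : ∀ {d x} → d ∣ x → ∣ x ∣ < ∣ d ∣ → x ≡ 0ℤ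
  ∣∧<⇒≡0 {d} {x} d∣x x<d = go ∣ x ∣ refl
    where
    go : ∀ m → ∣ x ∣ ≡ m → x ≡ 0ℤ
    go zero eq = ℤₚ.∣i∣≡0⇒i≡0 eq
    go (suc m) eq = contradiction (subst (_< ∣ d ∣) eq x<d)
      (ℕₚ.≤⇒≯ (ℕᵈ.∣⇒≤ (subst (∣ d ∣ ℕᵈ.∣_) eq (∣⇒∣ᵤ d∣x))))

  4^≡2^ : ∀ n → (+ 4) ^ n ≡ (+ 2) ^ (n ℕ.+ n)
  4^≡2^ zero = refl
  4^≡2^ (suc n) = begin
    + 4 * (+ 4) ^ n                    ≡⟨ cong (+ 4 *_) (4^≡2^ n) ⟩
    + 4 * (+ 2) ^ (n ℕ.+ n)            ≡⟨ ℤₚ.*-assoc (+ 2) (+ 2) _ ⟩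
    + 2 * ((+ 2) ^ suc (n ℕ.+ n))      ≡⟨ cong (λ m → + 2 * (+ 2) ^ m) (ℕₚ.+-suc n n) ⟨
    + 2 * ((+ 2) ^ (n ℕ.+ suc n))      ∎
    where open ≡-Reasoning

  ^-split : ∀ b {m n} → m ≤ n → b ^ n ≡ b ^ m * b ^ (n ∸ m)
  ^-split b {m} {n} m≤n = trans (cong (b ^_) (sym (ℕₚ.m+[n∸m]≡n m≤n))) (ℤₚ.^-distribˡ-+-* b m (n ∸ m))

  ^-∣ : ∀ b {m n} → m ≤ n → b ^ m ∣ b ^ n
  ^-∣ b {m} {n} m≤n = divides (b ^ (n ∸ m)) (trans (^-split b m≤n) (ℤₚ.*-comm (b ^ m) _))

  -- Integer sequences and null relations

  Seq : Set
  Seq = ℕ → ℤ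

  ∑ : Seq → ℕ → ℤ
  ∑ u zero = 0ℤ
  ∑ u (suc n) = ∑ u n + u n

  ∑-+ : ∀ u v n → ∑ (λ i → u i + v i) n ≡ ∑ u n + ∑ v n
  ∑-+ u v zero = refl
  ∑-+ u v (suc n) = trans (cong (_+ (u n + v n)) (∑-+ u v n)) (lemma (∑ u n) (∑ v n) (u n) (v n))
    where
    lemma : ∀ a b c d → a + b + (c + d) ≡ a + c + (b + d)
    lemma = solve-∀

  ∑-* : ∀ c u n → ∑ (λ i → c * u i) n ≡ c * ∑ u n
  ∑-* c u zero = sym (ℤₚ.*-zeroʳ c)
  ∑-* c u (suc n) = trans (cong (_+ c * u n) (∑-* c u n)) (sym (ℤₚ.*-distribˡ-+ c (∑ u n) (u n)))

  ∑-cong : ∀ {u v} → (∀ i → u i ≡ v i) → ∀ n → ∑ u n ≡ ∑ v n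
  ∑-cong u≗v zero = refl
  ∑-cong u≗v (suc n) = cong₂ _+_ (∑-cong u≗v n) (u≗v n)

  δ : ℕ → Seq
  δ n k = if does (n ≟ k) then 1ℤ else 0ℤ

  δ-diag : ∀ n → δ n n ≡ 1ℤ
  δ-diag n rewrite dec-true (n ≟ n) refl = refl

  δ-off : ∀ {n k} → n ≢ k → δ n k ≡ 0ℤ
  δ-off {n} {k} n≢k rewrite dec-false (n ≟ k) n≢k = refl

  ^-δ : ∀ c n k → c ^ n * δ n k ≡ c ^ k * δ n k
  ^-δ c n k with n ≟ k
  ... | yes refl = refl
  ... | no n≢k = trans (vanish (c ^ n)) (sym (vanish (c ^ k)))
    where
    vanish : ∀ x → x * δ n k ≡ 0ℤ
    vanish x = trans (cong (x *_) (δ-off n≢k)) (ℤₚ.*-zeroʳ x)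

  ∑δ≡0 : ∀ {n m} → m ≤ n → ∑ (δ n) m ≡ 0ℤ
  ∑δ≡0 {n} {zero} _ = refl
  ∑δ≡0 {n} {suc m} m<n = cong₂ _+_ (∑δ≡0 (ℕₚ.<⇒≤ m<n)) (δ-off (ℕₚ.>⇒≢ m<n))

  ∑δ≡1 : ∀ {n m} → n < m → ∑ (δ n) m ≡ 1ℤ
  ∑δ≡1 {n} {suc m} (s≤s n≤m) with ℕₚ.m≤n⇒m<n∨m≡n n≤m
  ... | inj₁ n<m = cong₂ _+_ (∑δ≡1 n<m) (δ-off (ℕₚ.<⇒≢ n<m))
  ... | inj₂ refl = cong₂ _+_ (∑δ≡0 (ℕₚ.≤-refl {n})) (δ-diag n)

  -- The relations 4^n e_n = a and 2 a = 0: the factorisation gives Σ v_n e_n = (Σ coeff_n) a.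
  record Null (v : Seq) : Set where
    field
      coeff      : Seq
      factor     : ∀ n → v n ≡ (+ 4) ^ n * coeff n
      bound      : ℕ
      vanishing  : ∀ n → bound ≤ n → coeff n ≡ 0ℤ
      even       : ∀ n → bound ≤ n → + 2 ∣ ∑ coeff n

  null-resp : ∀ {u v} → (∀ n → u n ≡ v n) → Null u → Null v
  null-resp u≗v N = record { Null N ; factor = λ n → trans (sym (u≗v n)) (Null.factor N n) }

  null-+ : ∀ {u v} → Null u → Null v → Null (λ n → u n + v n)
  null-+ {u} {v} M N = record
    { coeff = λ n → M.coeff n + N.coeff n
    ; factor = λ n → trans (cong₂ _+_ (M.factor n) (N.factor n)) (sym (ℤₚ.*-distribˡ-+ ((+ 4) ^ n) (M.coeff n) (N.coeff n)))
    ; bound = M.bound ℕ.+ N.bound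
    ; vanishing = λ n b≤n → cong₂ _+_ (M.vanishing n (ℕₚ.m+n≤o⇒m≤o M.bound b≤n)) (N.vanishing n (ℕₚ.m+n≤o⇒n≤o M.bound b≤n))
    ; even = λ n b≤n → subst (+ 2 ∣_) (sym (∑-+ M.coeff N.coeff n))
        (∣m∣n⇒∣m+n (M.even n (ℕₚ.m+n≤o⇒m≤o M.bound b≤n)) (N.even n (ℕₚ.m+n≤o⇒n≤o M.bound b≤n)))
    }
    where
    module M = Null M
    module N = Null N

  null-* : ∀ c {v} → Null v → Null (λ n → c * v n)
  null-* c {v} N = record
    { coeff = λ n → c * coeff n
    ; factor = λ n → trans (cong (c *_) (factor n)) (lemma c ((+ 4) ^ n) (coeff n))
    ; bound = bound
    ; vanishing = λ n b≤n → trans (cong (c *_) (vanishing n b≤n)) (ℤₚ.*-zeroʳ c)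
    ; even = λ n b≤n → subst (+ 2 ∣_) (sym (∑-* c coeff n)) (∣n⇒∣m*n c (even n b≤n))
    }
    where
    open Null N
    lemma : ∀ c x y → c * (x * y) ≡ x * (c * y)
    lemma = solve-∀

  null-0 : ∀ {v} → (∀ n → v n ≡ 0ℤ) → Null v
  null-0 v≗0 = record
    { coeff = λ _ → 0ℤ
    ; factor = λ n → trans (v≗0 n) (sym (ℤₚ.*-zeroʳ ((+ 4) ^ n)))
    ; bound = 0
    ; vanishing = λ _ _ → refl
    ; even = λ n _ → subst (+ 2 ∣_) (sym (∑-* 0ℤ (λ _ → 0ℤ) n)) (divides 0ℤ refl)
    }

  -- An odd number is invertible modulo 2 and modulo powers of 4, so it cancels from the coordinates
  -- and from the parity of the coefficient sum. Transitivity of equality rests on this.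
  null-cancel : ∀ c .{{_ : NonZero c}} → Coprime c (+ 2) → ∀ {v} → Null (λ n → c * v n) → Null v
  null-cancel c c⊥2 {v} N = record
    { coeff = κ
    ; factor = v≡
    ; bound = bound
    ; vanishing = λ n b≤n → ℤₚ.*-cancelˡ-≡ c (κ n) 0ℤ (trans (cκ≡ n) (trans (vanishing n b≤n) (sym (ℤₚ.*-zeroʳ c))))
    ; even = λ n b≤n → coprime-divisor c⊥2
        (subst (+ 2 ∣_) (trans (sym (∑-cong cκ≡ n)) (∑-* c κ n)) (even n b≤n))
    }
    where
    open Null N
    4^∣v : ∀ n → (+ 4) ^ n ∣ v n
    -- The product 2 * 2 evaluates to 4, so two copies of `c⊥2` give coprimality to 4.
    4^∣v n = coprime-divisor (coprime-^ʳ (coprime-*ʳ c⊥2 c⊥2) n)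
      (divides (coeff n) (trans (factor n) (ℤₚ.*-comm ((+ 4) ^ n) (coeff n))))
    κ : Seq
    κ n = quotient (4^∣v n)
    v≡ : ∀ n → v n ≡ (+ 4) ^ n * κ n
    v≡ n = trans (_∣_.equality (4^∣v n)) (ℤₚ.*-comm (κ n) ((+ 4) ^ n))
    cκ≡ : ∀ n → c * κ n ≡ coeff n
    cκ≡ n = ^-cancelˡ (+ 4) n (trans (lemma c ((+ 4) ^ n) (κ n)) (trans (cong (c *_) (sym (v≡ n))) (factor n)))
      where
      lemma : ∀ c x y → x * (c * y) ≡ c * (x * y)
      lemma = solve-∀

  -- Slow sequences

  -- `u n` is 2^(n - shift) times a bounded integer; multiplying through by 2^shift avoids negative
  -- exponents.
  record Slow (u : Seq) : Set where
    field
      shift   : ℕ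
      height  : ℕ
      coeff   : Seq
      factor  : ∀ n → (+ 2) ^ shift * u n ≡ (+ 2) ^ n * coeff n
      bounded : ∀ n → ∣ coeff n ∣ ≤ height

  abstract

    slow-+ : ∀ {u v} → Slow u → Slow v → Slow (λ n → u n + v n)
    slow-+ {u} {v} S T = record
      { shift = S.shift ℕ.+ T.shift
      ; height = ∣ (+ 2) ^ T.shift ∣ ℕ.* S.height ℕ.+ ∣ (+ 2) ^ S.shift ∣ ℕ.* T.height
      ; coeff = λ n → (+ 2) ^ T.shift * S.coeff n + (+ 2) ^ S.shift * T.coeff n
      ; factor = λ n → begin
          (+ 2) ^ (S.shift ℕ.+ T.shift) * (u n + v n)
            ≡⟨ cong (_* (u n + v n)) (ℤₚ.^-distribˡ-+-* (+ 2) S.shift T.shift) ⟩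
          (+ 2) ^ S.shift * (+ 2) ^ T.shift * (u n + v n)
            ≡⟨ expand ((+ 2) ^ S.shift) ((+ 2) ^ T.shift) (u n) (v n) ⟩
          (+ 2) ^ T.shift * ((+ 2) ^ S.shift * u n) + (+ 2) ^ S.shift * ((+ 2) ^ T.shift * v n)
            ≡⟨ cong₂ (λ x y → (+ 2) ^ T.shift * x + (+ 2) ^ S.shift * y) (S.factor n) (T.factor n) ⟩
          (+ 2) ^ T.shift * ((+ 2) ^ n * S.coeff n) + (+ 2) ^ S.shift * ((+ 2) ^ n * T.coeff n)
            ≡⟨ collect ((+ 2) ^ S.shift) ((+ 2) ^ T.shift) ((+ 2) ^ n) (S.coeff n) (T.coeff n) ⟩
          (+ 2) ^ n * ((+ 2) ^ T.shift * S.coeff n + (+ 2) ^ S.shift * T.coeff n) ∎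
      ; bounded = λ n → ℕₚ.≤-trans (ℤₚ.∣i+j∣≤∣i∣+∣j∣ ((+ 2) ^ T.shift * S.coeff n) ((+ 2) ^ S.shift * T.coeff n))
          (ℕₚ.+-mono-≤ (scaled ((+ 2) ^ T.shift) (S.bounded n)) (scaled ((+ 2) ^ S.shift) (T.bounded n)))
      }
      where
      module S = Slow S
      module T = Slow T
      open ≡-Reasoning
      expand : ∀ a b x y → a * b * (x + y) ≡ b * (a * x) + a * (b * y)
      expand = solve-∀
      collect : ∀ a b c x y → b * (c * x) + a * (c * y) ≡ c * (b * x + a * y)
      collect = solve-∀
      scaled : ∀ c {x H} → ∣ x ∣ ≤ H → ∣ c * x ∣ ≤ ∣ c ∣ ℕ.* H
      scaled c {x} x≤H = ℕₚ.≤-trans (ℕₚ.≤-reflexive (ℤₚ.abs-* c x)) (ℕₚ.*-monoʳ-≤ ∣ c ∣ x≤H)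

    slow-* : ∀ c {u} → Slow u → Slow (λ n → c * u n)
    slow-* c {u} S = record
      { shift = shift
      ; height = ∣ c ∣ ℕ.* height
      ; coeff = λ n → c * coeff n
      ; factor = λ n → trans (swap ((+ 2) ^ shift) c (u n)) (trans (cong (c *_) (factor n)) (swap c ((+ 2) ^ n) (coeff n)))
      ; bounded = λ n → ℕₚ.≤-trans (ℕₚ.≤-reflexive (ℤₚ.abs-* c (coeff n))) (ℕₚ.*-monoʳ-≤ ∣ c ∣ (bounded n))
      }
      where
      open Slow S
      swap : ∀ a c x → a * (c * x) ≡ c * (a * x)
      swap = solve-∀

    slow-0 : Slow (λ _ → 0ℤ)
    slow-0 = record
      { shift = 0 ; height = 0 ; coeff = λ _ → 0ℤ
      ; factor = λ n → sym (ℤₚ.*-zeroʳ ((+ 2) ^ n)) ; bounded = λ _ → z≤n }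

  ∣δ∣≤1 : ∀ n k → ∣ δ n k ∣ ≤ 1
  ∣δ∣≤1 n k with n ℕ.≡ᵇ k
  ... | true = ℕₚ.≤-refl
  ... | false = z≤n

  abstract

    slow-δ : ∀ n → Slow (δ n)
    slow-δ n = record
      { shift = n ; height = 1 ; coeff = δ n
      ; factor = ^-δ (+ 2) n
      ; bounded = ∣δ∣≤1 n }

  -- The coordinates of Σ 2^(k-l) e_k over the places k selected by `χ`. A positive `l` serves to
  -- divide a tail by 2^l, provided that no place lies below `l`.
  lacunary : (ℕ → Bool) → ℕ → Seq
  lacunary χ l k = if χ k then (+ 2) ^ (k ∸ l) else 0ℤ

  lacunary-shift : ∀ χ l → (∀ k → χ k ≡ true → l ≤ k) → ∀ k → (+ 2) ^ l * lacunary χ l k ≡ lacunary χ 0 k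
  lacunary-shift χ l l≤ k with χ k in eq
  ... | true = sym (^-split (+ 2) (l≤ k eq))
  ... | false = ℤₚ.*-zeroʳ ((+ 2) ^ l)

  abstract

    slow-lacunary : ∀ χ l → (∀ k → χ k ≡ true → l ≤ k) → Slow (lacunary χ l)
    slow-lacunary χ l l≤ = record
      { shift = l ; height = 1 ; coeff = λ k → if χ k then 1ℤ else 0ℤ
      ; factor = λ k → trans (lacunary-shift χ l l≤ k) (unfold k)
      ; bounded = bounded }
      where
      unfold : ∀ k → lacunary χ 0 k ≡ (+ 2) ^ k * (if χ k then 1ℤ else 0ℤ)
      unfold k with χ k
      ... | true = sym (ℤₚ.*-identityʳ _)
      ... | false = sym (ℤₚ.*-zeroʳ ((+ 2) ^ k))
      bounded : ∀ k → ∣ (if χ k then 1ℤ else 0ℤ) ∣ ≤ 1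
      bounded k with χ k
      ... | true = ℕₚ.≤-refl
      ... | false = z≤n

  -- The groups of slow sequences

  -- An element with denominator exponent s and sequence u stands for Σ u_n e_n / q^s with q = 1 + 2h,
  -- where e_n has order 2·4^n and 4^n e_n = a for all n.
  record Elem : Set where
    constructor elem
    field
      den  : ℕ
      seq  : Seq
      slow : Slow seq

  open Elem

  scale : ℤ → Elem → Elem
  scale c x = elem (den x) (λ n → c * seq x n) (slow-* c (slow x))

  𝟘 : Elem
  𝟘 = elem 0 (λ _ → 0ℤ) slow-0

  e : ℕ → Elem
  e n = elem 0 (δ n) (slow-δ n)

  module Localised (h : ℕ) where

    q : ℤ
    q = + suc (2 ℕ.* h)

    q⊥2 : Coprime q (+ 2)
    q⊥2 = 1ℤ , - + h , trans (cong (λ z → 1ℤ * (1ℤ + z) + - + h * + 2) (ℤₚ.pos-* 2 h)) (lemma (+ h))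
      where
      lemma : ∀ x → 1ℤ * (1ℤ + + 2 * x) + - x * + 2 ≡ 1ℤ
      lemma = solve-∀

    q^⊥2 : ∀ s → Coprime (q ^ s) (+ 2)
    q^⊥2 s = coprime-sym (coprime-^ʳ (coprime-sym q⊥2) s)

    q^⊥4^ : ∀ s n → Coprime (q ^ s) ((+ 4) ^ n)
    q^⊥4^ s n = coprime-^ʳ (coprime-*ʳ (q^⊥2 s) (q^⊥2 s)) n

    infix 4 _≈_
    -- Fractions are compared by cross-multiplication, up to consequences of 4^n e_n = a and 2 a =
    -- 0.
    record _≈_ (x y : Elem) : Set where
      constructor null
      field
        difference : Null (λ n → q ^ den y * seq x n - q ^ den x * seq y n)

    open _≈_

    ≡⇒≈ : ∀ {x y} → (∀ n → q ^ den y * seq x n ≡ q ^ den x * seq y n) → x ≈ y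
    ≡⇒≈ eq = null (null-0 (λ n → ℤₚ.i≡j⇒i-j≡0 (eq n)))

    ≗⇒≈ : ∀ {x y} → den x ≡ den y → (∀ n → seq x n ≡ seq y n) → x ≈ y
    ≗⇒≈ {x} refl eq = ≡⇒≈ (λ n → cong (q ^ den x *_) (eq n))

    ≈-refl : ∀ {x} → x ≈ x
    ≈-refl = ≗⇒≈ refl (λ _ → refl)

    ≈-sym : ∀ {x y} → x ≈ y → y ≈ x
    ≈-sym {x} {y} (null N) = null (null-resp
      (λ n → lemma (q ^ den y * seq x n) (q ^ den x * seq y n)) (null-* (- 1ℤ) N))
      where
      lemma : ∀ a b → - 1ℤ * (a - b) ≡ b - a
      lemma = solve-∀

    -- A combination of the two cross-multiplied differences is the wanted one times `q ^ den y`, an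
    -- odd factor that `null-cancel` removes.
    ≈-trans : ∀ {x y z} → x ≈ y → y ≈ z → x ≈ z
    ≈-trans {x} {y} {z} (null M) (null N) = null (null-cancel (q ^ den y) {{^-nonZero q (den y)}} (q^⊥2 (den y))
      (null-resp (λ n → lemma (q ^ den x) (q ^ den y) (q ^ den z) (seq x n) (seq y n) (seq z n))
        (null-+ (null-* (q ^ den z) M) (null-* (q ^ den x) N))))
      where
      lemma : ∀ X Y Z x y z → Z * (Y * x - X * y) + X * (Z * y - Y * z) ≡ Y * (Z * x - X * z)
      lemma = solve-∀

    infixl 6 _⊕_
    _⊕_ : Elem → Elem → Elem
    x ⊕ y = elem (den x ℕ.+ den y) (λ n → q ^ den y * seq x n + q ^ den x * seq y n)
      (slow-+ (slow-* (q ^ den y) (slow x)) (slow-* (q ^ den x) (slow y)))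

    ⊕-cong : ∀ {x x′ y y′} → x ≈ x′ → y ≈ y′ → x ⊕ y ≈ x′ ⊕ y′
    ⊕-cong {x} {x′} {y} {y′} (null M) (null N) = null (null-resp
      (λ n → trans
        (lemma (q ^ den x) (q ^ den x′) (q ^ den y) (q ^ den y′) (seq x n) (seq x′ n) (seq y n) (seq y′ n))
        (sym (cong₂ (λ a b → a * seq (x ⊕ y) n - b * seq (x′ ⊕ y′) n)
          (ℤₚ.^-distribˡ-+-* q (den x′) (den y′)) (ℤₚ.^-distribˡ-+-* q (den x) (den y)))))
      (null-+ (null-* (q ^ den y * q ^ den y′) M) (null-* (q ^ den x * q ^ den x′) N)))
      where
      lemma : ∀ X X′ Y Y′ x x′ y y′ →
        Y * Y′ * (X′ * x - X * x′) + X * X′ * (Y′ * y - Y * y′) ≡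
        X′ * Y′ * (Y * x + X * y) - X * Y * (Y′ * x′ + X′ * y′)
      lemma = solve-∀

    ⊕-congˡ : ∀ x {y y′} → y ≈ y′ → x ⊕ y ≈ x ⊕ y′
    ⊕-congˡ x y≈y′ = ⊕-cong (≈-refl {x}) y≈y′

    ⊕-assoc : ∀ x y z → (x ⊕ y) ⊕ z ≈ x ⊕ (y ⊕ z)
    ⊕-assoc x y z = ≗⇒≈ (ℕₚ.+-assoc (den x) (den y) (den z)) λ n → trans
      (cong (λ a → q ^ den z * seq (x ⊕ y) n + a * seq z n) (ℤₚ.^-distribˡ-+-* q (den x) (den y)))
      (trans (lemma (q ^ den x) (q ^ den y) (q ^ den z) (seq x n) (seq y n) (seq z n))
        (cong (λ a → a * seq x n + q ^ den x * seq (y ⊕ z) n) (sym (ℤₚ.^-distribˡ-+-* q (den y) (den z)))))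
      where
      lemma : ∀ X Y Z x y z → Z * (Y * x + X * y) + X * Y * z ≡ Y * Z * x + X * (Z * y + Y * z)
      lemma = solve-∀

    ⊕-comm : ∀ x y → x ⊕ y ≈ y ⊕ x
    ⊕-comm x y = ≗⇒≈ (ℕₚ.+-comm (den x) (den y)) λ n → ℤₚ.+-comm (q ^ den y * seq x n) (q ^ den x * seq y n)

    ⊕-identityˡ : ∀ x → 𝟘 ⊕ x ≈ x
    ⊕-identityˡ x = ≗⇒≈ refl λ n → lemma (q ^ den x) (seq x n)
      where
      lemma : ∀ X x → X * 0ℤ + 1ℤ * x ≡ x
      lemma = solve-∀

    ⊕-inverseˡ : ∀ x → scale (- 1ℤ) x ⊕ x ≈ 𝟘
    ⊕-inverseˡ x = ≡⇒≈ λ n → lemma (q ^ den x) (q ^ (den x ℕ.+ den x)) (seq x n)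
      where
      lemma : ∀ X Y x → 1ℤ * (X * (- 1ℤ * x) + X * x) ≡ Y * 0ℤ
      lemma = solve-∀

    scale-cong : ∀ c {x y} → x ≈ y → scale c x ≈ scale c y
    scale-cong c {x} {y} (null N) = null (null-resp
      (λ n → lemma c (q ^ den x) (q ^ den y) (seq x n) (seq y n)) (null-* c N))
      where
      lemma : ∀ c X Y x y → c * (Y * x - X * y) ≡ Y * (c * x) - X * (c * y)
      lemma = solve-∀

    scale-assoc : ∀ b c x → scale b (scale c x) ≈ scale (b * c) x
    scale-assoc b c x = ≗⇒≈ refl λ n → sym (ℤₚ.*-assoc b c (seq x n))

    scale-0 : ∀ x → scale 0ℤ x ≈ 𝟘
    scale-0 x = ≡⇒≈ λ n → lemma (q ^ den x) (seq x n)
      where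
      lemma : ∀ X x → 1ℤ * (0ℤ * x) ≡ X * 0ℤ
      lemma = solve-∀

    scale-1 : ∀ x → scale 1ℤ x ≈ x
    scale-1 x = ≗⇒≈ refl λ n → ℤₚ.*-identityˡ (seq x n)

    scale-suc : ∀ m x → scale (+ suc m) x ≈ x ⊕ scale (+ m) x
    scale-suc m x = ≡⇒≈ λ n → trans
      (cong (_* (+ suc m * seq x n)) (ℤₚ.^-distribˡ-+-* q (den x) (den x)))
      (lemma (q ^ den x) (+ m) (seq x n))
      where
      lemma : ∀ X m x → X * X * ((1ℤ + m) * x) ≡ X * (X * x + X * (m * x))
      lemma = solve-∀

    -- The difference has coefficient 1 at n and -1 at 0, so the coefficients add up to zero.
    4^e≈e₀ : ∀ n → scale ((+ 4) ^ n) (e n) ≈ e 0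
    4^e≈e₀ n = null record
      { coeff = λ k → δ n k + - 1ℤ * δ 0 k
      ; factor = λ k → trans (cong₂ (λ x y → 1ℤ * x - 1ℤ * y) (^-δ (+ 4) n k)
                   (trans (sym (ℤₚ.*-identityˡ (δ 0 k))) (^-δ (+ 4) 0 k)))
                   (lemma ((+ 4) ^ k) (δ n k) (δ 0 k))
      ; bound = suc n
      ; vanishing = λ k n<k → cong₂ (λ x y → x + - 1ℤ * y) (δ-off (ℕₚ.<⇒≢ n<k)) (δ-off (ℕₚ.<⇒≢ (ℕₚ.≤-trans (s≤s z≤n) n<k)))
      ; even = λ k n<k → divides 0ℤ (trans (∑-+ (δ n) (λ k → - 1ℤ * δ 0 k) k)
          (cong₂ _+_ (∑δ≡1 n<k) (trans (∑-* (- 1ℤ) (δ 0) k) (cong (- 1ℤ *_) (∑δ≡1 (ℕₚ.≤-trans (s≤s z≤n) n<k))))))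
      }
      where
      lemma : ∀ X x y → 1ℤ * (X * x) - 1ℤ * (X * y) ≡ X * (x + - 1ℤ * y)
      lemma = solve-∀

    e₀⊕e₀≈𝟘 : e 0 ⊕ e 0 ≈ 𝟘
    e₀⊕e₀≈𝟘 = null record
      { coeff = λ k → + 2 * δ 0 k
      ; factor = λ k → trans (lemma (δ 0 k)) (trans (cong (+ 2 *_) (trans (sym (ℤₚ.*-identityˡ (δ 0 k))) (^-δ (+ 4) 0 k)))
                   (swap ((+ 4) ^ k) (δ 0 k)))
      ; bound = 1
      ; vanishing = λ k 0<k → cong (+ 2 *_) (δ-off (ℕₚ.<⇒≢ 0<k))
      ; even = λ k _ → divides (∑ (δ 0) k) (trans (∑-* (+ 2) (δ 0) k) (ℤₚ.*-comm (+ 2) (∑ (δ 0) k)))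
      }
      where
      lemma : ∀ x → 1ℤ * (1ℤ * x + 1ℤ * x) - 1ℤ * 0ℤ ≡ + 2 * x
      lemma = solve-∀
      swap : ∀ X x → + 2 * (X * x) ≡ X * (+ 2 * x)
      swap = solve-∀

    signedGroup : SignedGroup
    signedGroup = record
      { abelianGroup = record
        { Carrier = Elem ; _≈_ = _≈_ ; _∙_ = _⊕_ ; ε = 𝟘 ; _⁻¹ = scale (- 1ℤ)
        ; isAbelianGroup = record
          { isGroup = record
            { isMonoid = record
              { isSemigroup = record
                { isMagma = record
                  { isEquivalence = record { refl = ≈-refl ; sym = ≈-sym ; trans = ≈-trans }
                  ; ∙-cong = ⊕-cong
                  }
                ; assoc = ⊕-assoc
                }
              ; identity = ⊕-identityˡ , λ x → ≈-trans (⊕-comm x 𝟘) (⊕-identityˡ x)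
              }
            ; inverse = ⊕-inverseˡ , λ x → ≈-trans (⊕-comm x (scale (- 1ℤ) x)) (⊕-inverseˡ x)
            ; ⁻¹-cong = scale-cong (- 1ℤ)
            }
          ; comm = ⊕-comm
          }
        }
      ; a = e 0
      ; a²≈ε = e₀⊕e₀≈𝟘
      }

    -- Coordinate subgroups and parity

    -- The subgroup of elements whose m-th coordinate vanishes in ℤ/4^m
    K : ℕ → Elem → Set
    K m x = (+ 4) ^ m ∣ seq x m

    K-0 : ∀ {m} x → seq x m ≡ 0ℤ → K m x
    K-0 x eq = divides 0ℤ eq

    -- Coordinate m of a null sequence is divisible by 4^m, and powers of `q` are invertible modulo
    -- 4^m.
    K-resp : ∀ {m x y} → x ≈ y → K m x → K m y
    K-resp {m} {x} {y} (null N) Kx = coprime-divisor (q^⊥4^ (den x) m)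
      (subst ((+ 4) ^ m ∣_) (lemma (q ^ den y * seq x m) (q ^ den x * seq y m))
        (∣m∣n⇒∣m-n (∣n⇒∣m*n (q ^ den y) Kx) (divides (coeff m) (trans (factor m) (ℤₚ.*-comm ((+ 4) ^ m) (coeff m))))))
      where
      open Null N
      lemma : ∀ a b → a - (a - b) ≡ b
      lemma = solve-∀

    K-cancelˡ : ∀ {m} x y → K m x → K m (x ⊕ y) → K m y
    K-cancelˡ {m} x y Kx Kxy = coprime-divisor (q^⊥4^ (den x) m)
      (∣m+n∣m⇒∣n Kxy (∣n⇒∣m*n (q ^ den y) Kx))

    K-cancelʳ : ∀ {m} x y → K m y → K m (x ⊕ y) → K m x
    K-cancelʳ x y Ky Kxy = K-cancelˡ y x Ky (K-resp (⊕-comm x y) Kxy)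

    K-scale : ∀ {m n} x → m ≤ n → K m (scale ((+ 2) ^ (n ℕ.+ n)) x)
    K-scale {m} {n} x m≤n = ∣m⇒∣m*n (seq x m) (subst ((+ 4) ^ m ∣_) (4^≡2^ n) (^-∣ (+ 4) m≤n))

    -- If 4^n w = a then Σ 4^(n-m) w_m is odd, so some w_m with m ≥ n is an odd multiple of 4^(m-n).
    parity : ∀ n w → scale ((+ 4) ^ suc n) w ≈ e 0 → ¬ (∀ m → suc n ≤ m → K m (scale ((+ 2) ^ suc n) w))
    parity n w (null N) Kw = 2∤1 (coprime-divisor (q^⊥2 (den w)) 2∣q^)
      where
      open Null N
      -- Only coordinate 0 sees e_0, which contributes the odd term `q ^ den w`.
      κ₀ : coeff 0 ≡ (+ 4) ^ suc n * seq w 0 + - (q ^ den w * 1ℤ)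
      κ₀ = trans (sym (ℤₚ.*-identityˡ (coeff 0))) (trans (sym (factor 0)) (cong (_- q ^ den w * 1ℤ) (ℤₚ.*-identityˡ ((+ 4) ^ suc n * seq w 0))))
      κ : ∀ m → 0 < m → (+ 4) ^ m * coeff m ≡ (+ 4) ^ suc n * seq w m
      κ (suc m) _ = trans (sym (factor (suc m))) (lemma ((+ 4) ^ suc n * seq w (suc m)) (q ^ den w))
        where
        lemma : ∀ x y → 1ℤ * x - y * 0ℤ ≡ x
        lemma = solve-∀
      2∣2^ : ∀ k x → + 2 ∣ (+ 2) ^ suc k * x
      2∣2^ k x = ∣m⇒∣m*n x (∣m⇒∣m*n ((+ 2) ^ k) ∣-refl)
      2∣4^ : ∀ k x → + 2 ∣ (+ 4) ^ suc k * x
      2∣4^ k x = ∣m⇒∣m*n x (∣m⇒∣m*n ((+ 4) ^ k) (divides (+ 2) refl))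
      κ-even : ∀ m → 0 < m → + 2 ∣ coeff m
      κ-even m 0<m with suc n ≤? m
      -- By hypothesis 4^m divides 2^(n+1) w_m, so after cancelling 4^m another factor 2^(n+1)
      -- remains.
      ... | yes n<m = subst (+ 2 ∣_) (sym (^-cancelˡ (+ 4) m (begin
          (+ 4) ^ m * coeff m                                ≡⟨ κ m 0<m ⟩
          (+ 4) ^ suc n * seq w m                            ≡⟨ cong (_* seq w m) (trans (4^≡2^ (suc n)) (ℤₚ.^-distribˡ-+-* (+ 2) (suc n) (suc n))) ⟩
          (+ 2) ^ suc n * (+ 2) ^ suc n * seq w m            ≡⟨ ℤₚ.*-assoc ((+ 2) ^ suc n) _ _ ⟩
          (+ 2) ^ suc n * ((+ 2) ^ suc n * seq w m)          ≡⟨ cong ((+ 2) ^ suc n *_) (_∣_.equality (Kw m n<m)) ⟩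
          (+ 2) ^ suc n * (quotient (Kw m n<m) * (+ 4) ^ m)  ≡⟨ swap ((+ 2) ^ suc n) (quotient (Kw m n<m)) ((+ 4) ^ m) ⟩
          (+ 4) ^ m * ((+ 2) ^ suc n * quotient (Kw m n<m))  ∎))) (2∣2^ n _)
        where
        open ≡-Reasoning
        swap : ∀ a b c → a * (b * c) ≡ c * (a * b)
        swap = solve-∀
      -- Here m ≤ n, so cancelling 4^m leaves a positive power of 4.
      ... | no n≮m = subst (+ 2 ∣_) (sym (^-cancelˡ (+ 4) m (begin
          (+ 4) ^ m * coeff m                               ≡⟨ κ m 0<m ⟩
          (+ 4) ^ suc n * seq w m                           ≡⟨ cong (_* seq w m) (^-split (+ 4) (ℕₚ.m≤n⇒m≤1+n m≤n)) ⟩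
          (+ 4) ^ m * (+ 4) ^ (suc n ∸ m) * seq w m         ≡⟨ cong (λ k → (+ 4) ^ m * (+ 4) ^ k * seq w m) (ℕₚ.+-∸-assoc 1 m≤n) ⟩
          (+ 4) ^ m * (+ 4) ^ suc (n ∸ m) * seq w m         ≡⟨ ℤₚ.*-assoc ((+ 4) ^ m) _ _ ⟩
          (+ 4) ^ m * ((+ 4) ^ suc (n ∸ m) * seq w m)       ∎))) (2∣4^ (n ∸ m) (seq w m))
        where
        open ≡-Reasoning
        m≤n : m ≤ n
        m≤n = ℕₚ.≤-pred (ℕₚ.≰⇒> n≮m)
      ∑≡κ₀ : ∀ m → ∃[ r ] (∑ coeff (suc m) ≡ coeff 0 + r × + 2 ∣ r)
      ∑≡κ₀ zero = 0ℤ , ℤₚ.+-comm 0ℤ (coeff 0) , divides 0ℤ refl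
      ∑≡κ₀ (suc m) with r , eq , 2∣r ← ∑≡κ₀ m =
        r + coeff (suc m) , trans (cong (_+ coeff (suc m)) eq) (ℤₚ.+-assoc (coeff 0) r _) ,
        ∣m∣n⇒∣m+n 2∣r (κ-even (suc m) (s≤s z≤n))
      2∣κ₀ : + 2 ∣ coeff 0
      -- The total is even and so are all later coefficients, hence also the one at 0. The sum runs
      -- to `suc bound` because `∑≡κ₀` splits off that first term.
      2∣κ₀ with r , eq , 2∣r ← ∑≡κ₀ bound = ∣m+n∣n⇒∣m (subst (+ 2 ∣_) eq (even (suc bound) (ℕₚ.n≤1+n bound))) 2∣r
      2∣q^ : + 2 ∣ q ^ den w * 1ℤ
      2∣q^ = subst (+ 2 ∣_) (ℤₚ.neg-involutive (q ^ den w * 1ℤ))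
        (∣m⇒∣-m (∣m+n∣m⇒∣n (subst (+ 2 ∣_) κ₀ 2∣κ₀) (2∣4^ n (seq w 0))))
      2∤1 : ¬ (+ 2 ∣ 1ℤ)
      2∤1 d = contradiction (∣∧<⇒≡0 d ℕₚ.≤-refl) λ ()

  -- Homomorphisms between these groups: finite supports

  record Hom (h h′ : ℕ) : Set where
    private
      module S = Localised h
      module T = Localised h′
    field
      f      : Elem → Elem
      f-cong : ∀ {x y} → x S.≈ y → f x T.≈ f y
      f-⊕    : ∀ x y → f (x S.⊕ y) T.≈ f x T.⊕ f y
      f-e₀   : f (e 0) T.≈ e 0

  module NoHom {h h′ : ℕ} (1≤h : 1 ≤ h)
    (r : ℤ) (q≡1+rp : Localised.q h′ ≡ 1ℤ + r * Localised.q h) (hom : Hom h h′) where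

    open Hom hom
    open Localised h′
    private module S = Localised h
    open S using () renaming (q to p)

    f-𝟘 : f 𝟘 ≈ 𝟘
    f-𝟘 = identityʳ-unique (f 𝟘) (f 𝟘) (≈-trans (≈-sym (f-⊕ 𝟘 𝟘)) (f-cong (S.⊕-identityˡ 𝟘)))
      where open import Algebra.Properties.Group (SignedGroup.group signedGroup) using (identityʳ-unique)

    f-scale : ∀ m x → f (scale (+ m) x) ≈ scale (+ m) (f x)
    f-scale zero x = ≈-trans (f-cong (S.scale-0 x)) (≈-trans f-𝟘 (≈-sym (scale-0 (f x))))
    f-scale (suc m) x = ≈-trans (f-cong (S.scale-suc m x)) (≈-trans (f-⊕ x (scale (+ m) x))
      (≈-trans (⊕-congˡ (f x) (f-scale m x)) (≈-sym (scale-suc m (f x)))))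

    f-scale-^ : ∀ b n x → f (scale ((+ b) ^ n) x) ≈ scale ((+ b) ^ n) (f x)
    f-scale-^ b zero x = ≈-trans (f-cong (S.scale-1 x)) (≈-sym (scale-1 (f x)))
    f-scale-^ b (suc n) x =
      ≈-trans (f-cong (S.≈-sym (S.scale-assoc (+ b) ((+ b) ^ n) x)))
        (≈-trans (f-scale b (scale ((+ b) ^ n) x))
          (≈-trans (scale-cong (+ b) (f-scale-^ b n x)) (scale-assoc (+ b) ((+ b) ^ n) (f x))))

    q⊥p : Coprime q p
    q⊥p = 1ℤ , - r , trans (cong (λ z → 1ℤ * z + - r * p) q≡1+rp) (lemma r p)
      where
      lemma : ∀ r p → 1ℤ * (1ℤ + r * p) + - r * p ≡ 1ℤ
      lemma = solve-∀

    -- The source is p-divisible, and a slow sequence that is eventually divisible by a large power of p vanishes eventually.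
    finite-support : ∀ x → ∃[ b ] (∀ n → b ≤ n → seq (f x) n ≡ 0ℤ)
    finite-support x = bound , λ n b≤n → ^-cancelˡ (+ 2) shift (begin
        (+ 2) ^ shift * seq (f x) n    ≡⟨ Slow.factor (slow (f x)) n ⟩
        (+ 2) ^ n * Slow.coeff (slow (f x)) n  ≡⟨ cong ((+ 2) ^ n *_) (coeff≡0 n b≤n) ⟩
        (+ 2) ^ n * 0ℤ                 ≡⟨ ℤₚ.*-zeroʳ ((+ 2) ^ n) ⟩
        0ℤ                             ≡⟨ ℤₚ.*-zeroʳ ((+ 2) ^ shift) ⟨
        (+ 2) ^ shift * 0ℤ             ∎)
      where
      open ≡-Reasoning
      open Slow (slow (f x)) using (shift) renaming (height to t)
      -- Division by p^t in the source just raises the denominator exponent; `t` is the height of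
      -- `f x`, so that p^t exceeds it.
      x/p^t : Elem
      x/p^t = elem (den x ℕ.+ t) (seq x) (slow x)
      x≈ : x S.≈ scale (p ^ t) x/p^t
      x≈ = S.≡⇒≈ λ n → trans (cong (_* seq x n) (ℤₚ.^-distribˡ-+-* p (den x) t)) (ℤₚ.*-assoc (p ^ den x) (p ^ t) (seq x n))
      y : Elem
      y = f x/p^t
      fx≈ : f x ≈ scale (p ^ t) y
      fx≈ = ≈-trans (f-cong x≈) (f-scale-^ (suc (2 ℕ.* h)) t x/p^t)
      open Null (_≈_.difference fx≈) using (bound; factor; vanishing)
      -- Beyond `bound` the equality of `f x` and p^t y holds coordinatewise in ℤ, up to powers of
      -- `q`, which are prime to `p`.
      p^t∣seq : ∀ n → bound ≤ n → p ^ t ∣ seq (f x) n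
      p^t∣seq n b≤n = coprime-divisor (coprime-^ q⊥p (den y) t) (divides (q ^ den (f x) * seq y n)
        (trans (ℤₚ.i-j≡0⇒i≡j (q ^ den y * seq (f x) n) (q ^ den (f x) * (p ^ t * seq y n)) (trans (factor n) (trans (cong ((+ 4) ^ n *_) (vanishing n b≤n)) (ℤₚ.*-zeroʳ ((+ 4) ^ n)))))
          (lemma (q ^ den (f x)) (p ^ t) (seq y n))))
        where
        lemma : ∀ a b c → a * (b * c) ≡ a * c * b
        lemma = solve-∀
      -- As `p` is odd, p^t divides the coefficient itself, whose absolute value is at most t < p^t;
      -- `1≤h` gives p ≥ 2.
      coeff≡0 : ∀ n → bound ≤ n → Slow.coeff (slow (f x)) n ≡ 0ℤ
      coeff≡0 n b≤n = ∣∧<⇒≡0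
        (coprime-divisor (coprime-^ (coprime-sym S.q⊥2) n t)
          (subst (p ^ t ∣_) (Slow.factor (slow (f x)) n) (∣n⇒∣m*n ((+ 2) ^ shift) (p^t∣seq n b≤n))))
        (ℕₚ.≤-<-trans (Slow.bounded (slow (f x)) n)
          (ℕₚ.<-≤-trans (n<b^n (s≤s (ℕₚ.≤-trans 1≤h (ℕₚ.m≤m+n h _))) t) (ℕₚ.≤-reflexive (sym (abs-^ p t)))))

    -- This concerns the image `f x`: its coordinates vanish from this index on.
    support : Elem → ℕ
    support x = proj₁ (finite-support x)

    K-beyond : ∀ x {m} → support x ≤ m → K m (f x)
    K-beyond x {m} s≤m = K-0 (f x) (proj₂ (finite-support x) m s≤m)

    -- Greedy choice of places

    -- The places n of the lacunary element Σ 2^n e_n are chosen greedily: the next place is beyond the threshold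
    -- set by the supports of the images of what has been chosen so far.
    term : ∀ n {t} → Dec (t ≤ n) → Elem
    term n (yes _) = scale ((+ 2) ^ n) (e n)
    term n (no _) = 𝟘

    raise : ∀ n {t} → Elem → Dec (t ≤ n) → ℕ
    raise n {t} z (yes _) = t ℕ.+ (support z ℕ.+ (support (e n) ℕ.+ support (e n)))
    raise n {t} z (no _) = t

    state : ℕ → ℕ × Elem
    -- Starting beyond `support 𝟘` gives the base case of `partial-K`; `suc` prevents 0 from being a
    -- place.
    state zero = suc (support 𝟘) , 𝟘
    state (suc n) with t , z ← state n =
      let z′ = z S.⊕ term n (t ≤? n) in raise n z′ (t ≤? n) , z′

    threshold : ℕ → ℕ
    threshold n = proj₁ (state n)

    partial : ℕ → Elem
    partial n = proj₂ (state n)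

    place? : ∀ n → Dec (threshold n ≤ n)
    place? n = threshold n ≤? n

    raise-≥ : ∀ n {t} z (d : Dec (t ≤ n)) → t ≤ raise n z d
    raise-≥ n z (yes _) = ℕₚ.m≤m+n _ _
    raise-≥ n z (no _) = ℕₚ.≤-refl

    threshold-step : ∀ n → threshold n ≤ threshold (suc n)
    threshold-step n = raise-≥ n (partial (suc n)) (place? n)

    threshold-mono : ∀ {m n} → m ≤ n → threshold m ≤ threshold n
    threshold-mono {m} {n} m≤n = subst (λ k → threshold m ≤ threshold k) (ℕₚ.m+[n∸m]≡n m≤n) (go (n ∸ m))
      where
      go : ∀ d → threshold m ≤ threshold (m ℕ.+ d)
      go zero = ℕₚ.≤-reflexive (cong threshold (sym (ℕₚ.+-identityʳ m)))
      go (suc d) = ℕₚ.≤-trans (go d) (ℕₚ.≤-trans (threshold-step (m ℕ.+ d)) (ℕₚ.≤-reflexive (cong threshold (sym (ℕₚ.+-suc m d)))))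

    threshold-stays : ∀ n → ¬ (threshold n ≤ n) → threshold (suc n) ≡ threshold n
    threshold-stays n = go (partial (suc n)) (place? n)
      where
      go : ∀ {t} z (d : Dec (t ≤ n)) → ¬ (t ≤ n) → raise n z d ≡ t
      go z (yes t≤n) t≰n = contradiction t≤n t≰n
      go z (no _) _ = refl

    threshold-bound : ∀ n → threshold n ≤ n → support (e n) ℕ.+ support (e n) ≤ threshold (suc n)
    threshold-bound n = go (partial (suc n)) (place? n)
      where
      go : ∀ {t} z (d : Dec (t ≤ n)) → t ≤ n → support (e n) ℕ.+ support (e n) ≤ raise n z d
      go {t} z (yes _) _ = ℕₚ.≤-trans (ℕₚ.m≤n+m _ (support z)) (ℕₚ.m≤n+m _ t)
      go z (no t≰n) t≤n = contradiction t≤n t≰n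

    -- At a place, `raise` has passed the support of the new image. Otherwise 𝟘 is added, which may
    -- change the representative of the image, but `K` is invariant under that.
    partial-K : ∀ n {m} → threshold n ≤ m → K m (f (partial n))
    partial-K zero t≤m = K-beyond 𝟘 (ℕₚ.≤-trans (ℕₚ.n≤1+n _) t≤m)
    partial-K (suc n) = go (partial n) (place? n) (partial-K n)
      where
      go : ∀ {t} z (d : Dec (t ≤ n)) → (∀ {m} → t ≤ m → K m (f z)) →
           ∀ {m} → raise n (z S.⊕ term n d) d ≤ m → K m (f (z S.⊕ term n d))
      go {t} z d@(yes _) _ r≤m = K-beyond (z S.⊕ term n d) (ℕₚ.≤-trans (ℕₚ.≤-trans (ℕₚ.m≤m+n _ _) (ℕₚ.m≤n+m _ t)) r≤m)
      go z (no _) Kz t≤m = K-resp (f-cong (S.≈-trans (S.≈-sym (S.⊕-identityˡ z)) (S.⊕-comm 𝟘 z))) (Kz t≤m)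

    -- The threshold is constant while no place occurs, so `n` catches up with it; `d` bounds the
    -- gap and decreases.
    places-unbounded : ∀ l → ∃[ n ] (l ≤ n × threshold n ≤ n)
    places-unbounded l = go (threshold l) l (ℕₚ.m≤n+m _ l)
      where
      go : ∀ d n → threshold n ≤ n ℕ.+ d → ∃[ n′ ] (n ≤ n′ × threshold n′ ≤ n′)
      go zero n t≤ = n , ℕₚ.≤-refl , subst (threshold n ≤_) (ℕₚ.+-identityʳ n) t≤
      go (suc d) n t≤ with place? n
      ... | yes t≤n = n , ℕₚ.≤-refl , t≤n
      ... | no t≰n with n′ , n<n′ , t≤n′ ← go d (suc n) (subst (_≤ suc n ℕ.+ d) (sym (threshold-stays n t≰n)) (subst (threshold n ≤_) (ℕₚ.+-suc n d) t≤))
        = n′ , ℕₚ.<⇒≤ n<n′ , t≤n′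

    -- The lacunary sum and its tails

    χ : ℕ → ℕ → Bool
    χ n k = does (n ≤? k) ∧ does (place? k)

    χ-true : ∀ n k → χ n k ≡ true → n ≤ k × threshold k ≤ k
    χ-true n k = go (n ≤? k) (place? k)
      where
      go : ∀ {A B : Set} (a? : Dec A) (b? : Dec B) → does a? ∧ does b? ≡ true → A × B
      go (yes a) (yes b) _ = a , b
      go (yes _) (no _) ()

    rest : ℕ → Elem
    rest n = elem 0 (lacunary (χ n) 0) (slow-lacunary (χ n) 0 (λ _ _ → z≤n))

    χ-above : ∀ {n k} → n ≤ k → χ n k ≡ does (place? k)
    χ-above {n} {k} n≤k = cong (_∧ does (place? k)) (dec-true (n ≤? k) n≤k)

    χ-below : ∀ {n k} → k < n → χ n k ≡ false
    χ-below {n} {k} k<n = cong (_∧ does (place? k)) (dec-false (n ≤? k) (ℕₚ.<⇒≱ k<n))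

    at : ℕ → Bool → ℤ
    at k b = if b then (+ 2) ^ k else 0ℤ

    lacunary-split : ∀ n k → lacunary (χ n) 0 k ≡ at n (does (place? n)) * δ n k + lacunary (χ (suc n)) 0 k
    lacunary-split n k with ℕₚ.<-cmp n k
    ... | tri< n<k n≢k _ = begin
        at k (χ n k)                                            ≡⟨ cong (at k) (trans (χ-above (ℕₚ.<⇒≤ n<k)) (sym (χ-above n<k))) ⟩
        at k (χ (suc n) k)                                      ≡⟨ drop (at n (does (place? n))) _ ⟩
        at n (does (place? n)) * 0ℤ + at k (χ (suc n) k)        ≡⟨ cong (λ z → at n (does (place? n)) * z + at k (χ (suc n) k)) (δ-off n≢k) ⟨
        at n (does (place? n)) * δ n k + at k (χ (suc n) k)     ∎
      where
      open ≡-Reasoning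
      drop : ∀ x y → y ≡ x * 0ℤ + y
      drop = solve-∀
    ... | tri> _ n≢k k<n = begin
        at k (χ n k)                                            ≡⟨ cong (at k) (χ-below k<n) ⟩
        0ℤ                                                      ≡⟨ drop (at n (does (place? n))) ⟩
        at n (does (place? n)) * 0ℤ + 0ℤ                        ≡⟨ cong₂ (λ y z → at n (does (place? n)) * y + z) (δ-off n≢k) (cong (at k) (χ-below (ℕₚ.m<n⇒m<1+n k<n))) ⟨
        at n (does (place? n)) * δ n k + at k (χ (suc n) k)     ∎
      where
      open ≡-Reasoning
      drop : ∀ x → 0ℤ ≡ x * 0ℤ + 0ℤ
      drop = solve-∀
    ... | tri≈ _ refl _ = begin
        at n (χ n n)                                            ≡⟨ cong (at n) (χ-above {n} ℕₚ.≤-refl) ⟩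
        at n (does (place? n))                                  ≡⟨ unit _ ⟩
        at n (does (place? n)) * 1ℤ + 0ℤ                        ≡⟨ cong₂ (λ y z → at n (does (place? n)) * y + z) (δ-diag n) (cong (at n) (χ-below {suc n} ℕₚ.≤-refl)) ⟨
        at n (does (place? n)) * δ n n + at n (χ (suc n) n)     ∎
      where
      open ≡-Reasoning
      unit : ∀ x → x ≡ x * 1ℤ + 0ℤ
      unit = solve-∀

    rest-step : ∀ n → rest n S.≈ term n (place? n) S.⊕ rest (suc n)
    rest-step n = go (place? n) (lacunary-split n)
      where
      unit : ∀ x y → 1ℤ * (x + y) ≡ 1ℤ * (1ℤ * x + 1ℤ * y)
      unit = solve-∀
      go : ∀ {t} (d : Dec (t ≤ n)) →
           (∀ k → lacunary (χ n) 0 k ≡ at n (does d) * δ n k + lacunary (χ (suc n)) 0 k) →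
           rest n S.≈ term n d S.⊕ rest (suc n)
      go {t} (yes u) split = S.≡⇒≈ λ k → trans (cong (1ℤ *_) (split k)) (unit (seq (term n {t} (yes u)) k) (lacunary (χ (suc n)) 0 k))
      go {t} (no u) split = S.≡⇒≈ λ k → trans (cong (1ℤ *_) (split k)) (unit (seq (term n {t} (no u)) k) (lacunary (χ (suc n)) 0 k))

    -- A homomorphism is known to respect finite sums only, so finitely many terms are peeled off
    -- the infinite sum.
    rest₀≈ : ∀ n → rest 0 S.≈ partial n S.⊕ rest n
    rest₀≈ zero = S.≈-sym (S.⊕-identityˡ (rest 0))
    rest₀≈ (suc n) = S.≈-trans (rest₀≈ n) (S.≈-trans (S.⊕-congˡ (partial n) (rest-step n))
      (S.≈-sym (S.⊕-assoc (partial n) (term n (place? n)) (rest (suc n)))))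

    term-yes : ∀ n {t} (d : Dec (t ≤ n)) → t ≤ n → term n d ≡ scale ((+ 2) ^ n) (e n)
    term-yes n (yes _) _ = refl
    term-yes n (no t≰n) t≤n = contradiction t≤n t≰n

    -- Continuity and the contradiction

    -- This is the 2-adic continuity. With s = `support (e n)`, the next threshold is at least 2s,
    -- so the tail is 4^s times another slow element, and `f` commutes with that factor.
    K-rest : ∀ n → threshold n ≤ n → ∀ {m} → m ≤ support (e n) → K m (f (rest (suc n)))
    K-rest n t≤n m≤s = K-resp (≈-sym (≈-trans (f-cong rest≈) (f-scale-^ 2 (s ℕ.+ s) tail))) (K-scale (f tail) m≤s)
      where
      s = support (e n)
      2s≤ : ∀ k → χ (suc n) k ≡ true → s ℕ.+ s ≤ k
      2s≤ k eq with n<k , t≤k ← χ-true (suc n) k eq =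
        ℕₚ.≤-trans (threshold-bound n t≤n) (ℕₚ.≤-trans (threshold-mono n<k) t≤k)
      tail : Elem
      tail = elem 0 (lacunary (χ (suc n)) (s ℕ.+ s)) (slow-lacunary (χ (suc n)) (s ℕ.+ s) 2s≤)
      rest≈ : rest (suc n) S.≈ scale ((+ 2) ^ (s ℕ.+ s)) tail
      rest≈ = S.≗⇒≈ refl λ k → sym (lacunary-shift (χ (suc n)) (s ℕ.+ s) 2s≤ k)

    -- Beyond the support of f(e_n) its coordinates vanish. Up to it, the images of the whole sum,
    -- of the earlier terms and of the tail all lie in `K m`, which leaves the image of the single
    -- term 2^n e_n there too.
    K-place : ∀ n → threshold n ≤ n → support (rest 0) ≤ n → ∀ m → n ≤ m → K m (scale ((+ 2) ^ n) (f (e n)))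
    K-place n t≤n s≤n m n≤m with ℕₚ.≤-total m (support (e n))
    ... | inj₂ s≤m = ∣n⇒∣m*n ((+ 2) ^ n) (K-beyond (e n) s≤m)
    ... | inj₁ m≤s = K-resp (f-scale-^ 2 n (e n))
        (K-cancelʳ (f 2ⁿe) (f (rest (suc n))) (K-rest n t≤n m≤s)
          (K-cancelˡ (f (partial n)) (f 2ⁿe ⊕ f (rest (suc n))) (partial-K n (ℕₚ.≤-trans t≤n n≤m))
            (K-resp split (K-beyond (rest 0) (ℕₚ.≤-trans s≤n n≤m)))))
      where
      2ⁿe = scale ((+ 2) ^ n) (e n)
      split : f (rest 0) ≈ f (partial n) ⊕ (f 2ⁿe ⊕ f (rest (suc n)))
      split = ≈-trans (f-cong (rest₀≈ n)) (≈-trans (f-⊕ (partial n) (rest n)) (⊕-congˡ (f (partial n))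
        (≈-trans (f-cong (subst (λ x → rest n S.≈ x S.⊕ rest (suc n)) (term-yes n (place? n) t≤n) (rest-step n)))
          (f-⊕ 2ⁿe (rest (suc n))))))

    absurd : ⊥
    absurd = let n , s≤n , t≤n = places-unbounded (support (rest 0)) in go n s≤n t≤n
      where
      go : ∀ n → support (rest 0) ≤ n → threshold n ≤ n → ⊥
      -- Place 0 cannot occur, as its threshold is positive. The image of e_(n+1) satisfies the
      -- equation in `parity`, and `K-place` supplies what `parity` refutes.
      go (suc n) s≤n t≤n = parity n (f (e (suc n)))
        (≈-trans (≈-sym (f-scale-^ 4 (suc n) (e (suc n)))) (≈-trans (f-cong (S.4^e≈e₀ (suc n))) f-e₀))
        (K-place (suc n) t≤n s≤n)

  -- The odd numbers q_i and the bad sequence in characteristic 2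

  -- half i is half of the product 2 q_0 ⋯ q_(i-1), where q_j = 1 + 2 half j.
  half : ℕ → ℕ
  half zero = 1
  half (suc i) = half i ℕ.* suc (2 ℕ.* half i)

  1≤half : ∀ i → 1 ≤ half i
  1≤half zero = ℕₚ.≤-refl
  1≤half (suc i) = ℕₚ.*-mono-≤ (1≤half i) (s≤s z≤n)

  half-divisible : ∀ {i j} → j < i → suc (2 ℕ.* half j) ℕᵈ.∣ half i
  half-divisible {suc i} {j} (s≤s j≤i) with ℕₚ.m≤n⇒m<n∨m≡n j≤i
  ... | inj₁ j<i = ℕᵈ.∣m⇒∣m*n (suc (2 ℕ.* half i)) (half-divisible j<i)
  ... | inj₂ refl = ℕᵈ.n∣m*n (half i)

  module _ where
    open Localised using (q; signedGroup)

    q≡1-mod : ∀ {i j} → j < i → ∃[ r ] (q (half i) ≡ 1ℤ + r * q (half j))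
    q≡1-mod {i} {j} j<i with ℕᵈ.divides k eq ← half-divisible j<i = + (2 ℕ.* k) , (begin
      1ℤ + + (2 ℕ.* half i)                         ≡⟨ cong (λ m → 1ℤ + + (2 ℕ.* m)) eq ⟩
      1ℤ + + (2 ℕ.* (k ℕ.* suc (2 ℕ.* half j)))     ≡⟨ cong (λ m → 1ℤ + + m) (ℕₚ.*-assoc 2 k _) ⟨
      1ℤ + + (2 ℕ.* k ℕ.* suc (2 ℕ.* half j))       ≡⟨ cong (λ z → 1ℤ + z) (ℤₚ.pos-* (2 ℕ.* k) _) ⟩
      1ℤ + + (2 ℕ.* k) * q (half j)                 ∎)
      where open ≡-Reasoning

    bad-sequence-2≈0 : (F : FiniteField 0ℓ 0ℓ) → Characteristic2 F → BadSequence F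
    bad-sequence-2≈0 F 2≈0 = (λ i → GroupRing.partialField (G i) , AugmentationToField.groupRing→field F 2≈0 (G i))
        , λ {i} {j} j<i φ → no-hom i j j<i φ
      where
      G : ℕ → SignedGroup
      G i = signedGroup (half i)
      no-hom : ∀ i j → j < i → ¬ PFHom (GroupRing.partialField (G j)) (GroupRing.partialField (G i))
      no-hom i j j<i φ = NoHom.absurd (1≤half j) (proj₁ (q≡1-mod j<i)) (proj₂ (q≡1-mod j<i))
        (record { f = f ; f-cong = f-cong ; f-⊕ = f-homo ; f-e₀ = f-a })
        where open GroupRingHom {G j} {G i} φ

open OddCharacteristic using (bad-sequence-2≉0)
open SlowSequences using (bad-sequence-2≈0)

theorem3p12 : (F : FiniteField 0ℓ 0ℓ) → ¬ IsWQO (HomToF F) (_⪰H_ {F = F})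
-- Equality in `F` need not be decidable. As the goal is a contradiction, the case 1 + 1 = 0 is
-- refuted first, and this refutation is the hypothesis of the other case.
theorem3p12 F wqo = not-good (bad-sequence-2≉0 F λ 2≈0 → not-good (bad-sequence-2≈0 F 2≈0))
  where
  not-good : ¬ BadSequence F
  not-good (s , bad) with i , j , j<i , si⪰sj ← IsWQO.good wqo s = bad j<i si⪰sj
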